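{- Let $G$ be a unit disk graph with $\alpha(G)\leq 2$. Then $G$ can be coloured with at most $\frac{3}{2}\omega(G)$ colours, that is, $\chi(G)\leq \frac{3}{2}\omega(G)$.
   Context: A unit disk graph is a graph $G$ whose vertex set $V(G)$ is a finite set of points in $\mathbb{R}^2$ (distinct vertices are distinct points), where two distinct vertices are adjacent if and only if their Euclidean distance is at most $1$. A clique is a set of pairwise adjacent vertices and a stable set is a set of pairwise non-adjacent vertices; $\omega(G)$ is the size of a largest clique, $\alpha(G)$ (the stability of $G$) is the size of a largest stable set, and $\chi(G)$ is the chromatic number. -}

module Defs where

open import Data.Empty using (⊥-elim)
open import Data.Fin.Base using (Fin)
open import Data.Fin.Subset using (Subset; _∈_; ∣_∣; ⊥)
open import Data.Fin.Subset.Properties using (∉⊥; ∣⊥∣≡0; ∣p∣≤n)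
open import Data.Integer.Base as ℤ using (+_; -[1+_])
import Data.Integer.DivMod as ℤ
import Data.Integer.Properties as ℤ
open import Data.Nat.Base as ℕ using (ℕ; zero; suc)
import Data.Nat.DivMod as ℕ
import Data.Nat.Properties as ℕ
open import Data.Nat.Induction using (<-rec)
open import Data.Product.Base using (Σ; ∃; _×_; _,_; proj₁; proj₂)
open import Data.Rational.Base
  using (ℚ; mkℚ; 0ℚ; 1ℚ; ½; _/_; _≤_; _<_; _+_; _*_; -_; _-_; _⊔_; floor;
         toℚᵘ; Positive; NonNegative; positive; nonNegative; 1/_)
  renaming (∣_∣ to abs)
open import Data.Rational.Properties as ℚ
open import Data.Rational.Solver using (module +-*-Solver)
open import Data.Rational.Unnormalised.Base as ℚᵘ using (mkℚᵘ; *≡*; *≤*; *<*)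
import Data.Rational.Unnormalised.Properties as ℚᵘ
open import Data.Sum.Base using (inj₁; inj₂)
open import Function.Base using (id; _∘_)
open import Function.Definitions using (Injective)
open import Level using (0ℓ)
open import Relation.Binary.Core using (Rel)
open import Relation.Binary.Definitions using (Symmetric; Irreflexive)
open import Relation.Binary.PropositionalEquality
  using (_≡_; _≢_; refl; sym; trans; cong; cong₂; subst; subst₂)
open import Relation.Nullary using (¬_; yes; no)
open import Relation.Unary using (Pred)

open +-*-Solver using (solve; _:+_; _:*_; _:-_; :-_; _:=_; con)

fromℕ : ℕ → ℚ
fromℕ n = + n / 1

toℚᵘ-/ : ∀ n d → toℚᵘ (n / suc d) ℚᵘ.≃ mkℚᵘ n d
toℚᵘ-/ n d = toℚᵘ-fromℚᵘ (mkℚᵘ n d)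

fromℕ-mono-≤ : ∀ {m n} → m ℕ.≤ n → fromℕ m ≤ fromℕ n
fromℕ-mono-≤ {m} {n} m≤n = toℚᵘ-cancel-≤
  (ℚᵘ.≤-respˡ-≃ (ℚᵘ.≃-sym (toℚᵘ-/ (+ m) 0)) (ℚᵘ.≤-respʳ-≃ (ℚᵘ.≃-sym (toℚᵘ-/ (+ n) 0))
    (*≤* (ℤ.*-monoʳ-≤-nonNeg (+ 1) (ℤ.+≤+ m≤n)))))

0≤fromℕ : ∀ n → 0ℚ ≤ fromℕ n
0≤fromℕ n = fromℕ-mono-≤ {0} {n} ℕ.z≤n

0<fromℕ-suc : ∀ n → 0ℚ < fromℕ (suc n)
0<fromℕ-suc n = <-≤-trans (positive⁻¹ 1ℚ) (fromℕ-mono-≤ {1} {suc n} (ℕ.s≤s ℕ.z≤n))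

fromℕ-* : ∀ m n → fromℕ (m ℕ.* n) ≡ fromℕ m * fromℕ n
fromℕ-* m n = toℚᵘ-injective (begin
  toℚᵘ (fromℕ (m ℕ.* n))               ≈⟨ toℚᵘ-/ (+ (m ℕ.* n)) 0 ⟩
  mkℚᵘ (+ (m ℕ.* n)) 0                 ≈⟨ *≡* (cong (ℤ._* + 1) (ℤ.pos-* m n)) ⟩
  mkℚᵘ (+ m) 0 ℚᵘ.* mkℚᵘ (+ n) 0       ≈⟨ ℚᵘ.*-cong (toℚᵘ-/ (+ m) 0) (toℚᵘ-/ (+ n) 0) ⟨
  toℚᵘ (fromℕ m) ℚᵘ.* toℚᵘ (fromℕ n)   ≈⟨ toℚᵘ-homo-* (fromℕ m) (fromℕ n) ⟨
  toℚᵘ (fromℕ m * fromℕ n)             ∎)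
  where open ℚᵘ.≃-Reasoning

/-*-cancel : ∀ m n → (+ m / suc n) * fromℕ (suc n) ≡ fromℕ m
/-*-cancel m n = toℚᵘ-injective (begin
  toℚᵘ ((+ m / suc n) * fromℕ (suc n))             ≈⟨ toℚᵘ-homo-* (+ m / suc n) (fromℕ (suc n)) ⟩
  toℚᵘ (+ m / suc n) ℚᵘ.* toℚᵘ (fromℕ (suc n))     ≈⟨ ℚᵘ.*-cong (toℚᵘ-/ (+ m) n) (toℚᵘ-/ (+ suc n) 0) ⟩
  mkℚᵘ (+ m) n ℚᵘ.* mkℚᵘ (+ suc n) 0               ≈⟨ *≡* (trans (ℤ.*-assoc (+ m) (+ suc n) (+ 1))
                                                               (cong (+ m ℤ.*_) (sym (ℤ.pos-* (suc n) 1)))) ⟩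
  mkℚᵘ (+ m) 0                                     ≈⟨ toℚᵘ-/ (+ m) 0 ⟨
  toℚᵘ (fromℕ m)                                   ∎)
  where open ℚᵘ.≃-Reasoning

1/N≤ : ∀ {ε} → 0ℚ < ε → ∃ λ N → ∀ {n} → N ℕ.≤ n → + 1 / suc n ≤ ε
1/N≤ {ε@(mkℚ (+ suc a) d _)} _ = d , λ {n} d≤n → toℚᵘ-cancel-≤
  (ℚᵘ.≤-respˡ-≃ (ℚᵘ.≃-sym (toℚᵘ-/ (+ 1) n)) (*≤* (subst₂ ℤ._≤_ (sym (ℤ.*-identityˡ (+ suc d)))
    (ℤ.pos-* (suc a) (suc n))
    (ℤ.+≤+ (ℕ.≤-trans (ℕ.s≤s d≤n) (ℕ.m≤m+n (suc n) (a ℕ.* suc n)))))))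
1/N≤ {mkℚ (+ 0) _ _}     0<ε = ⊥-elim (ℤ.<-irrefl refl (drop-*<* 0<ε))
1/N≤ {mkℚ -[1+ _ ] _ _}  0<ε with () ← drop-*<* 0<ε

floor-nonNeg : ∀ {q} → 0ℚ ≤ q →
               fromℕ ℤ.∣ floor q ∣ ≤ q × q < fromℕ (suc ℤ.∣ floor q ∣)
floor-nonNeg {mkℚ -[1+ _ ] _ _} 0≤q with () ← drop-*≤* 0≤q
floor-nonNeg {q@(mkℚ (+ a) d _)} _ = lower , upper
  where
  k = a ℕ./ suc d
  floor≡ : ℤ.∣ floor q ∣ ≡ k
  floor≡ = cong ℤ.∣_∣ (ℤ.div-pos-is-/ℕ (+ a) (suc d))
  lower : fromℕ ℤ.∣ floor q ∣ ≤ q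
  lower rewrite floor≡ = toℚᵘ-cancel-≤ (ℚᵘ.≤-respˡ-≃ (ℚᵘ.≃-sym (toℚᵘ-/ (+ k) 0))
    (*≤* (subst₂ ℤ._≤_ (ℤ.pos-* k (suc d)) (sym (ℤ.*-identityʳ (+ a)))
      (ℤ.+≤+ (ℕ.m/n*n≤m a (suc d))))))
  upper : q < fromℕ (suc ℤ.∣ floor q ∣)
  upper rewrite floor≡ = toℚᵘ-cancel-< (ℚᵘ.<-respʳ-≃ (ℚᵘ.≃-sym (toℚᵘ-/ (+ suc k) 0))
    (*<* (subst₂ ℤ._<_ (sym (ℤ.*-identityʳ (+ a))) (ℤ.pos-* (suc k) (suc d))
      (ℤ.+<+ (subst (ℕ._< suc d ℕ.+ k ℕ.* suc d) (sym (ℕ.m≡m%n+[m/n]*n a (suc d)))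
        (ℕ.+-monoˡ-< (k ℕ.* suc d) (ℕ.m%n<n a (suc d))))))))

*-mono-≤-nonNeg : ∀ {p q r s} → 0ℚ ≤ q → 0ℚ ≤ r → p ≤ q → r ≤ s → p * r ≤ q * s
*-mono-≤-nonNeg {p} {q} {r} {s} 0≤q 0≤r p≤q r≤s =
  ≤-trans (*-monoʳ-≤-nonNeg r {{nonNegative 0≤r}} p≤q)
          (*-monoˡ-≤-nonNeg q {{nonNegative 0≤q}} r≤s)

*-nonNeg : ∀ {p q} → 0ℚ ≤ p → 0ℚ ≤ q → 0ℚ ≤ p * q
*-nonNeg {p} {q} 0≤p 0≤q =
  subst (_≤ p * q) (*-zeroʳ p) (*-monoˡ-≤-nonNeg p {{nonNegative 0≤p}} 0≤q)

+-pos : ∀ {p q} → 0ℚ < p → 0ℚ < q → 0ℚ < p + q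
+-pos = +-mono-<

*-pos : ∀ {p q} → 0ℚ < p → 0ℚ < q → 0ℚ < p * q
*-pos {p} {q} 0<p 0<q = positive⁻¹ _ {{pos*pos⇒pos p {{positive 0<p}} q {{positive 0<q}}}}

½*-pos : ∀ {p} → 0ℚ < p → 0ℚ < ½ * p
½*-pos = *-pos (positive⁻¹ ½)

abs-≤ : ∀ {p q r} → p ≤ q + r → q ≤ p + r → abs (p - q) ≤ r
abs-≤ {p} {q} {r} p≤q+r q≤p+r with ∣p∣≡p∨∣p∣≡-p (p - q)
... | inj₁ eq = subst₂ _≤_ (sym eq) (solve 2 (λ q r → q :+ r :- q := r) refl q r)
                  (+-monoˡ-≤ (- q) p≤q+r)
... | inj₂ eq = subst₂ _≤_ (trans (solve 2 (λ p q → q :- p := :- (p :- q)) refl p q) (sym eq))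
                  (solve 2 (λ p r → p :+ r :- p := r) refl p r) (+-monoˡ-≤ (- p) q≤p+r)

p≤abs : ∀ p → p ≤ abs p
p≤abs p with ≤-total 0ℚ p
... | inj₁ 0≤p = ≤-reflexive (sym (0≤p⇒∣p∣≡p 0≤p))
... | inj₂ p≤0 = ≤-trans p≤0 (0≤∣p∣ p)

abs-sym : ∀ p q → abs (p - q) ≡ abs (q - p)
abs-sym p q = trans (sym (∣-p∣≡∣p∣ (p - q))) (cong abs (solve 2 (λ p q → :- (p :- q) := q :- p) refl p q))

≤+abs : ∀ {p q r} → abs (p - q) ≤ r → p ≤ q + r
≤+abs {p} {q} {r} h = subst (_≤ q + r) (solve 2 (λ p q → q :+ (p :- q) := p) refl p q)
  (+-monoʳ-≤ q (≤-trans (p≤abs (p - q)) h))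

isqrt : ℕ → ℕ
isqrt zero    = zero
isqrt (suc m) with suc (isqrt m) ℕ.* suc (isqrt m) ℕ.≤? suc m
... | yes _ = suc (isqrt m)
... | no  _ = isqrt m

isqrt-lower : ∀ m → isqrt m ℕ.* isqrt m ℕ.≤ m
isqrt-lower zero    = ℕ.z≤n
isqrt-lower (suc m) with suc (isqrt m) ℕ.* suc (isqrt m) ℕ.≤? suc m
... | yes p = p
... | no  _ = ℕ.m≤n⇒m≤1+n (isqrt-lower m)

isqrt-upper : ∀ m → m ℕ.< suc (isqrt m) ℕ.* suc (isqrt m)
isqrt-upper zero    = ℕ.s≤s ℕ.z≤n
isqrt-upper (suc m) with suc (isqrt m) ℕ.* suc (isqrt m) ℕ.≤? suc m
... | yes _ = ℕ.≤-<-trans (isqrt-upper m) (ℕ.*-mono-< (ℕ.n<1+n r) (ℕ.n<1+n r))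
  where r = suc (isqrt m)
... | no ¬p = ℕ.≰⇒> ¬p

-- For q ≥ 0, the largest multiple of 1/(n+1) whose square is at most q.
√-approx : ℕ → ℚ → ℚ
√-approx n q = + isqrt ℤ.∣ floor (q * (fromℕ (suc n) * fromℕ (suc n))) ∣ / suc n

module _ (n : ℕ) {q : ℚ} (0≤q : 0ℚ ≤ q) where
  private
    N N² M J s δ : ℚ
    m j : ℕ
    N = fromℕ (suc n)
    N² = N * N
    m = ℤ.∣ floor (q * N²) ∣
    j = isqrt m
    M = fromℕ m
    J = fromℕ j
    s = √-approx n q
    δ = + 1 / suc n

    0<N² : 0ℚ < N²
    0<N² = *-pos (0<fromℕ-suc n) (0<fromℕ-suc n)

    instance
      N-pos : Positive N
      N-pos = positive (0<fromℕ-suc n)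
      N²-pos : Positive N²
      N²-pos = positive 0<N²
      N²-nonNeg : NonNegative N²
      N²-nonNeg = nonNegative (<⇒≤ 0<N²)

    0≤qN² : 0ℚ ≤ q * N²
    0≤qN² = *-nonNeg 0≤q (<⇒≤ 0<N²)

    sN≡J : s * N ≡ J
    sN≡J = /-*-cancel j n

    ssN² : (s * s) * N² ≡ fromℕ (j ℕ.* j)
    ssN² = trans (solve 2 (λ s N → (s :* s) :* (N :* N) := (s :* N) :* (s :* N)) refl s N)
             (trans (cong₂ _*_ sN≡J sN≡J) (sym (fromℕ-* j j)))

    [s+δ]N≡ : (s + δ) * N ≡ fromℕ (suc j)
    [s+δ]N≡ = trans (*-distribʳ-+ N s δ) (trans (cong₂ _+_ sN≡J (/-*-cancel 1 n)) J+1)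
      where
      J+1 : J + 1ℚ ≡ fromℕ (suc j)
      J+1 = toℚᵘ-injective (begin
        toℚᵘ (J + 1ℚ)                      ≈⟨ toℚᵘ-homo-+ J 1ℚ ⟩
        toℚᵘ J ℚᵘ.+ mkℚᵘ (+ 1) 0           ≈⟨ ℚᵘ.+-congˡ (mkℚᵘ (+ 1) 0) (toℚᵘ-/ (+ j) 0) ⟩
        mkℚᵘ (+ j) 0 ℚᵘ.+ mkℚᵘ (+ 1) 0     ≈⟨ *≡* (cong (ℤ._* + 1) (trans
            (cong (ℤ._+ + 1) (ℤ.*-identityʳ (+ j))) (cong +_ (ℕ.+-comm j 1)))) ⟩
        mkℚᵘ (+ suc j) 0                   ≈⟨ toℚᵘ-/ (+ suc j) 0 ⟨
        toℚᵘ (fromℕ (suc j))               ∎)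
        where open ℚᵘ.≃-Reasoning

  √-approx-nonNeg : 0ℚ ≤ √-approx n q
  √-approx-nonNeg = *-cancelʳ-≤-pos N
    (subst₂ _≤_ (sym (*-zeroˡ N)) (sym sN≡J) (0≤fromℕ j))

  √-approx-lower : √-approx n q * √-approx n q ≤ q
  √-approx-lower = *-cancelʳ-≤-pos N² (subst (_≤ q * N²) (sym ssN²)
    (≤-trans (fromℕ-mono-≤ (isqrt-lower m)) (proj₁ (floor-nonNeg 0≤qN²))))

  √-approx-upper : q < (√-approx n q + + 1 / suc n) * (√-approx n q + + 1 / suc n)
  √-approx-upper = *-cancelʳ-<-nonNeg N² (subst (q * N² <_) (sym eq)
    (<-≤-trans (proj₂ (floor-nonNeg 0≤qN²)) (fromℕ-mono-≤ (isqrt-upper m))))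
    where
    eq : ((s + δ) * (s + δ)) * N² ≡ fromℕ (suc j ℕ.* suc j)
    eq = trans (solve 2 (λ s N → (s :* s) :* (N :* N) := (s :* N) :* (s :* N)) refl (s + δ) N)
           (trans (cong₂ _*_ [s+δ]N≡ [s+δ]N≡) (sym (fromℕ-* (suc j) (suc j))))

√-approx-continuous : ∀ {m n q r ε} → 0ℚ < ε → 0ℚ ≤ q → 0ℚ ≤ r →
                      + 1 / suc n ≤ ½ * ε → q ≤ r + (½ * ε) * (½ * ε) →
                      √-approx m q ≤ √-approx n r + ε
√-approx-continuous {m} {n} {q} {r} {ε} 0<ε 0≤q 0≤r 1/n≤ q≤ = ≮⇒≥ λ t+ε<s →
  <-irrefl refl (begin-strict
    (t + ε) * (t + ε)              ≤⟨ *-mono-≤-nonNeg 0≤s 0≤t+ε (<⇒≤ t+ε<s) (<⇒≤ t+ε<s) ⟩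
    s * s                          ≤⟨ √-approx-lower m 0≤q ⟩
    q                              ≤⟨ q≤ ⟩
    r + η * η                      <⟨ +-monoˡ-< (η * η) (√-approx-upper n 0≤r) ⟩
    (t + δ) * (t + δ) + η * η      ≤⟨ +-monoˡ-≤ (η * η) (*-mono-≤-nonNeg (+-nonNeg 0≤t 0≤η) (+-nonNeg 0≤t 0≤δ)
                                        (+-monoʳ-≤ t 1/n≤) (+-monoʳ-≤ t 1/n≤)) ⟩
    (t + η) * (t + η) + η * η      ≤⟨ p≤p+q′ (*-nonNeg 0≤η (+-nonNeg 0≤t+η 0≤t+η)) ⟩
    (t + η) * (t + η) + η * η + η * ((t + η) + (t + η))
      ≡⟨ solve 2 (λ t η → (t :+ η) :* (t :+ η) :+ η :* η :+ η :* ((t :+ η) :+ (t :+ η))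
                       := (t :+ (η :+ η)) :* (t :+ (η :+ η))) refl t η ⟩
    (t + (η + η)) * (t + (η + η))  ≡⟨ cong (λ e → (t + e) * (t + e)) η+η≡ε ⟩
    (t + ε) * (t + ε)              ∎)
  where
  open ≤-Reasoning
  η δ s t : ℚ
  η = ½ * ε
  δ = + 1 / suc n
  s = √-approx m q
  t = √-approx n r
  +-nonNeg : ∀ {x y} → 0ℚ ≤ x → 0ℚ ≤ y → 0ℚ ≤ x + y
  +-nonNeg = +-mono-≤
  p≤p+q′ : ∀ {p q} → 0ℚ ≤ q → p ≤ p + q
  p≤p+q′ {p} {q} 0≤q = subst (_≤ p + q) (+-identityʳ p) (+-monoʳ-≤ p 0≤q)
  η+η≡ε : η + η ≡ ε
  η+η≡ε = trans (sym (*-distribʳ-+ ε ½ ½)) (*-identityˡ ε)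
  0≤η = <⇒≤ (½*-pos 0<ε)
  0≤s = √-approx-nonNeg m 0≤q
  0≤t = √-approx-nonNeg n 0≤r
  0≤δ : 0ℚ ≤ δ
  0≤δ = *-cancelʳ-≤-pos (fromℕ (suc n)) {{positive (0<fromℕ-suc n)}}
          (subst₂ _≤_ (sym (*-zeroˡ (fromℕ (suc n)))) (sym (/-*-cancel 1 n)) (0≤fromℕ 1))
  0≤t+ε = +-nonNeg 0≤t (<⇒≤ 0<ε)
  0≤t+η = +-nonNeg 0≤t 0≤η

record ℝ : Set where
  field
    seq    : ℕ → ℚ
    cauchy : ∀ {ε} → 0ℚ < ε →
             ∃ λ N → ∀ {m n} → N ℕ.≤ m → N ℕ.≤ n → abs (seq m - seq n) ≤ ε

open ℝ public

infix  4 _≤ᴿ_ _≃ᴿ_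
infixl 6 _+ᴿ_ _-ᴿ_
infixl 7 _*ᴿ_
infix  8 -ᴿ_

_≤ᴿ_ : Rel ℝ 0ℓ
x ≤ᴿ y = ∀ {ε} → 0ℚ < ε → ∃ λ N → ∀ {n} → N ℕ.≤ n → seq x n ≤ seq y n + ε

_≃ᴿ_ : Rel ℝ 0ℓ
x ≃ᴿ y = x ≤ᴿ y × y ≤ᴿ x

fromℚ : ℚ → ℝ
fromℚ q .seq _ = q
fromℚ q .cauchy {ε} 0<ε = 0 , λ _ _ → subst (λ d → abs d ≤ ε) (sym (+-inverseʳ q)) (<⇒≤ 0<ε)

1ᴿ : ℝ
1ᴿ = fromℚ 1ℚ

abs-+-≤ : ∀ {p q r s} → abs p ≤ r → abs q ≤ s → abs (p + q) ≤ r + s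
abs-+-≤ {p} {q} p≤r q≤s = ≤-trans (∣p+q∣≤∣p∣+∣q∣ p q) (+-mono-≤ p≤r q≤s)

_+ᴿ_ : ℝ → ℝ → ℝ
(x +ᴿ y) .seq n = seq x n + seq y n
(x +ᴿ y) .cauchy {ε} 0<ε with cauchy x (½*-pos 0<ε) | cauchy y (½*-pos 0<ε)
... | M , hx | N , hy = M ℕ.⊔ N , λ {m} {n} ≤m ≤n →
  subst₂ _≤_
    (cong abs (solve 4 (λ a b c d → (a :- c) :+ (b :- d) := (a :+ b) :- (c :+ d)) refl
      (seq x m) (seq y m) (seq x n) (seq y n)))
    (trans (sym (*-distribʳ-+ ε ½ ½)) (*-identityˡ ε))
    (abs-+-≤ (hx (ℕ.m⊔n≤o⇒m≤o M N ≤m) (ℕ.m⊔n≤o⇒m≤o M N ≤n))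
             (hy (ℕ.m⊔n≤o⇒n≤o M N ≤m) (ℕ.m⊔n≤o⇒n≤o M N ≤n)))

-ᴿ_ : ℝ → ℝ
(-ᴿ x) .seq n = - seq x n
(-ᴿ x) .cauchy {ε} 0<ε with cauchy x 0<ε
... | N , h = N , λ {m} {n} ≤m ≤n → subst (_≤ ε)
  (cong abs (solve 2 (λ a b → b :- a := :- a :- (:- b)) refl (seq x m) (seq x n))) (h ≤n ≤m)

_-ᴿ_ : ℝ → ℝ → ℝ
x -ᴿ y = x +ᴿ (-ᴿ y)

eventually-bounded : ∀ x → ∃ λ B → 0ℚ < B × ∃ λ N → ∀ {n} → N ℕ.≤ n → abs (seq x n) ≤ B
eventually-bounded x with cauchy x (positive⁻¹ 1ℚ)
... | N , h = 1ℚ + abs (seq x N) , +-mono-<-≤ (positive⁻¹ 1ℚ) (0≤∣p∣ (seq x N)) , N , λ {n} ≤n →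
  subst (λ p → abs p ≤ 1ℚ + abs (seq x N))
    (solve 2 (λ a b → (a :- b) :+ b := a) refl (seq x n) (seq x N))
    (abs-+-≤ (h ≤n ℕ.≤-refl) ≤-refl)

*-distribˡ-- : ∀ p q r → p * (q - r) ≡ p * q - p * r
*-distribˡ-- p q r = trans (*-distribˡ-+ p q (- r)) (cong (λ s → p * q + s) (sym (neg-distribʳ-* p r)))

*-difference : ∀ p q r s → p * (q - s) + s * (p - r) ≡ p * q - r * s
*-difference p q r s = trans
  (cong₂ _+_ (*-distribˡ-- p q s) (trans (*-distribˡ-- s p r) (cong₂ _-_ (*-comm s p) (*-comm s r))))
  (solve 3 (λ a b c → (a :- b) :+ (b :- c) := a :- c) refl (p * q) (p * s) (r * s))

abs-*-≤ : ∀ {p q r s} → 0ℚ < r → abs p ≤ r → abs q ≤ s → abs (p * q) ≤ r * s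
abs-*-≤ {p} {q} {r} {s} 0<r p≤r q≤s = subst (_≤ r * s) (sym (∣p*q∣≡∣p∣*∣q∣ p q))
  (*-mono-≤-nonNeg (<⇒≤ 0<r) (0≤∣p∣ q) p≤r q≤s)

*-continuous : ∀ {B C δ} p q r s → 0ℚ < B → 0ℚ < C → abs p ≤ B → abs s ≤ C →
               abs (p - r) ≤ δ → abs (q - s) ≤ δ → abs (p * q - r * s) ≤ B * δ + C * δ
*-continuous {B} {C} {δ} p q r s 0<B 0<C p≤B s≤C p-r q-s =
  subst (λ d → abs d ≤ B * δ + C * δ) (*-difference p q r s)
    (abs-+-≤ {p * (q - s)} {s * (p - r)}
      (abs-*-≤ {p} {q - s} 0<B p≤B q-s) (abs-*-≤ {s} {p - r} 0<C s≤C p-r))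

divide : ∀ {p q} → 0ℚ < p → 0ℚ < q → ∃ λ r → 0ℚ < r × p * r ≡ q
divide {p} {q} 0<p 0<q = 1/ p * q
  , *-pos (positive⁻¹ (1/ p) {{1/pos⇒pos p}}) 0<q
  , trans (sym (*-assoc p (1/ p) q)) (trans (cong (_* q) (*-inverseʳ p)) (*-identityˡ q))
  where
  instance
    p-pos : Positive p
    p-pos = positive 0<p
    p-nonZero = pos⇒nonZero p

_*ᴿ_ : ℝ → ℝ → ℝ
(x *ᴿ y) .seq n = seq x n * seq y n
(x *ᴿ y) .cauchy {ε} 0<ε =
  let B , 0<B , K , x≤B   = eventually-bounded x
      C , 0<C , L , y≤C   = eventually-bounded y
      δ , 0<δ , [B+C]δ≡ε  = divide (+-pos 0<B 0<C) 0<ε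
      M , hx              = cauchy x 0<δ
      N , hy              = cauchy y 0<δ
      KL≤ : ∀ {k} → (K ℕ.⊔ L) ℕ.⊔ (M ℕ.⊔ N) ℕ.≤ k → K ℕ.⊔ L ℕ.≤ k
      KL≤ = ℕ.m⊔n≤o⇒m≤o (K ℕ.⊔ L) (M ℕ.⊔ N)
      MN≤ : ∀ {k} → (K ℕ.⊔ L) ℕ.⊔ (M ℕ.⊔ N) ℕ.≤ k → M ℕ.⊔ N ℕ.≤ k
      MN≤ = ℕ.m⊔n≤o⇒n≤o (K ℕ.⊔ L) (M ℕ.⊔ N)
  in (K ℕ.⊔ L) ℕ.⊔ (M ℕ.⊔ N) , λ {m} {n} ≤m ≤n →
    subst (abs (seq x m * seq y m - seq x n * seq y n) ≤_)
      (trans (sym (*-distribʳ-+ δ B C)) [B+C]δ≡ε)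
      (*-continuous (seq x m) (seq y m) (seq x n) (seq y n) 0<B 0<C
        (x≤B (ℕ.m⊔n≤o⇒m≤o K L (KL≤ ≤m))) (y≤C (ℕ.m⊔n≤o⇒n≤o K L (KL≤ ≤n)))
        (hx (ℕ.m⊔n≤o⇒m≤o M N (MN≤ ≤m)) (ℕ.m⊔n≤o⇒m≤o M N (MN≤ ≤n)))
        (hy (ℕ.m⊔n≤o⇒n≤o M N (MN≤ ≤m)) (ℕ.m⊔n≤o⇒n≤o M N (MN≤ ≤n))))

⊔0-mono-+ : ∀ {p q r} → 0ℚ ≤ r → p ≤ q + r → p ⊔ 0ℚ ≤ (q ⊔ 0ℚ) + r
⊔0-mono-+ {p} {q} {r} 0≤r p≤ = ⊔-lub
  (≤-trans p≤ (+-monoˡ-≤ r (p≤p⊔q q 0ℚ)))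
  (+-mono-≤ (p≤q⊔p q 0ℚ) 0≤r)

-- The nonnegative square root of max(x,0).
√ : ℝ → ℝ
√ x .seq n = √-approx n (seq x n ⊔ 0ℚ)
√ x .cauchy {ε} 0<ε =
  let 0<η² = *-pos (½*-pos 0<ε) (½*-pos 0<ε)
      M , hx = cauchy x 0<η²
      N , hN = 1/N≤ (½*-pos 0<ε)
      close : ∀ {m n} → M ℕ.⊔ N ℕ.≤ m → M ℕ.⊔ N ℕ.≤ n →
              √-approx m (seq x m ⊔ 0ℚ) ≤ √-approx n (seq x n ⊔ 0ℚ) + ε
      close = λ {m} {n} ≤m ≤n → √-approx-continuous {m} {n} {seq x m ⊔ 0ℚ} {seq x n ⊔ 0ℚ} 0<ε
        (p≤q⊔p (seq x m) 0ℚ) (p≤q⊔p (seq x n) 0ℚ)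
        (hN (ℕ.m⊔n≤o⇒n≤o M N ≤n))
        (⊔0-mono-+ {seq x m} {seq x n} (<⇒≤ 0<η²)
          (≤+abs {seq x m} {seq x n} (hx (ℕ.m⊔n≤o⇒m≤o M N ≤m) (ℕ.m⊔n≤o⇒m≤o M N ≤n))))
  in M ℕ.⊔ N , λ {m} {n} ≤m ≤n →
    abs-≤ {√-approx m (seq x m ⊔ 0ℚ)} {√-approx n (seq x n ⊔ 0ℚ)} (close ≤m ≤n) (close ≤n ≤m)

Point : Set
Point = ℝ × ℝ

infix 4 _≃ᴾ_

_≃ᴾ_ : Rel Point 0ℓ
(x , y) ≃ᴾ (x′ , y′) = x ≃ᴿ x′ × y ≃ᴿ y′

dist : Point → Point → ℝ
dist (x , y) (x′ , y′) = √ ((x -ᴿ x′) *ᴿ (x -ᴿ x′) +ᴿ (y -ᴿ y′) *ᴿ (y -ᴿ y′))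

square-sym : ∀ p q → (p - q) * (p - q) ≡ (q - p) * (q - p)
square-sym = solve 2 (λ p q → (p :- q) :* (p :- q) := (q :- p) :* (q :- p)) refl

dist-sym : ∀ p q n → seq (dist p q) n ≡ seq (dist q p) n
dist-sym (x , y) (x′ , y′) n = cong (λ d → √-approx n (d ⊔ 0ℚ))
  (cong₂ _+_ (square-sym (seq x n) (seq x′ n)) (square-sym (seq y n) (seq y′ n)))

record Graph : Set₁ where
  infix 4 _~_
  field
    order  : ℕ
    _~_    : Rel (Fin order) 0ℓ
    symm   : Symmetric _~_
    irrefl : Irreflexive _≡_ _~_

  Clique : Pred (Subset order) 0ℓ
  Clique S = ∀ {i j} → i ∈ S → j ∈ S → i ≢ j → i ~ j

  Stable : Pred (Subset order) 0ℓ
  Stable S = ∀ {i j} → i ∈ S → j ∈ S → i ≢ j → ¬ i ~ j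

  HasClique HasStable Colourable : Pred ℕ 0ℓ
  HasClique  k = ∃ λ S → Clique S × ∣ S ∣ ≡ k
  HasStable  k = ∃ λ S → Stable S × ∣ S ∣ ≡ k
  Colourable k = Σ (Fin order → Fin k) λ c → ∀ {i j} → i ~ j → c i ≢ c j

IsGreatest IsLeast : Pred ℕ 0ℓ → Pred ℕ 0ℓ
IsGreatest P m = P m × (∀ {k} → P k → k ℕ.≤ m)
IsLeast    P m = P m × (∀ {k} → P k → m ℕ.≤ k)

-- Adjacency of points in ℝ² is not decidable, so ω(G), α(G) and χ(G) are given as the
-- (unique) values of relations rather than computed. The lemmas below show
-- that these values cannot fail to exist.
module _ (G : Graph) where
  open Graph G

  IsCliqueNumber IsStability IsChromaticNumber : Pred ℕ 0ℓ
  IsCliqueNumber    = IsGreatest HasClique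
  IsStability       = IsGreatest HasStable
  IsChromaticNumber = IsLeast Colourable

¬¬-least : ∀ {P : Pred ℕ 0ℓ} {m} → P m → ¬ ¬ ∃ (IsLeast P)
¬¬-least {P} {m} Pm ¬least = <-rec (λ k → ¬ P k)
  (λ k rec Pk → ¬least (k , Pk , λ Pl → ℕ.≮⇒≥ λ l<k → rec l<k Pl)) m Pm

¬¬-greatest : ∀ {P : Pred ℕ 0ℓ} {m b} → (∀ {k} → P k → k ℕ.≤ b) → P m → ¬ ¬ ∃ (IsGreatest P)
¬¬-greatest {P} {m} {b} bounded Pm ¬greatest = ¬¬-least
  {P = λ d → P (b ℕ.∸ d)} {m = b ℕ.∸ m}
  (subst P (sym (ℕ.m∸[m∸n]≡n (bounded Pm))) Pm)
  λ (d , Pd , least) → ¬greatest (b ℕ.∸ d , Pd , λ {k} Pk →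
    subst (ℕ._≤ b ℕ.∸ d) (ℕ.m∸[m∸n]≡n (bounded Pk))
      (ℕ.∸-monoʳ-≤ b (least {b ℕ.∸ k} (subst P (sym (ℕ.m∸[m∸n]≡n (bounded Pk))) Pk))))

module _ (G : Graph) where
  open Graph G

  ¬¬-cliqueNumber : ¬ ¬ ∃ (IsCliqueNumber G)
  ¬¬-cliqueNumber = ¬¬-greatest {P = HasClique} {b = order}
    (λ (S , _ , ∣S∣≡k) → subst (ℕ._≤ order) ∣S∣≡k (∣p∣≤n S))
    (⊥ , (λ i∈⊥ _ _ → ⊥-elim (∉⊥ i∈⊥)) , ∣⊥∣≡0 order)

  ¬¬-stability : ¬ ¬ ∃ (IsStability G)
  ¬¬-stability = ¬¬-greatest {P = HasStable} {b = order}
    (λ (S , _ , ∣S∣≡k) → subst (ℕ._≤ order) ∣S∣≡k (∣p∣≤n S))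
    (⊥ , (λ i∈⊥ _ _ → ⊥-elim (∉⊥ i∈⊥)) , ∣⊥∣≡0 order)

  ¬¬-chromaticNumber : ¬ ¬ ∃ (IsChromaticNumber G)
  ¬¬-chromaticNumber = ¬¬-least {P = Colourable} (id , λ i~j i≡j → irrefl i≡j i~j)

record UnitDiskGraph : Set where
  field
    size     : ℕ
    point    : Fin size → Point
    distinct : Injective _≡_ _≃ᴾ_ point

  graph : Graph
  graph = record
    { order  = size
    ; _~_    = λ i j → i ≢ j × dist (point i) (point j) ≤ᴿ 1ᴿ
    ; symm   = λ {i} {j} (i≢j , d≤1) → i≢j ∘ sym , λ 0<ε → proj₁ (d≤1 0<ε) , λ {n} ≤n →
                 subst (_≤ _) (dist-sym (point i) (point j) n) (proj₂ (d≤1 0<ε) ≤n)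
    ; irrefl = λ i≡j (i≢j , _) → i≢j i≡j
    }

{-# OPTIONS --safe #-}
-- Let H be the complement of G, which is triangle-free; the points may be taken rational.
-- Some vertex v has a closed neighbourhood in G that is the union of two cliques through v.  If
-- two points u, w are at distance at least √3, take v = u: the other points near u are either
-- far from w or in the lens around u and w, whose diameter is at most 1.  Otherwise any three
-- points lie in a unit disc, by Helly's theorem so do all of them, and v is a point farthest from
-- its centre o: the line vo cuts the neighbourhood into two halves of diameter at most 1.  As the
-- non-neighbours of v form a clique, every nonempty induced subgraph satisfies |S| + 1 ≤ 3ω(S).
--
-- A matching of H missing d of the vertices of S colours S with (|S| + d) / 2 colours, so it
-- suffices to find one with |S| + d ≤ 3ω(S).  If some vertex is covered by every maximum
-- matching, delete it; if H[S] is disconnected, treat its parts separately.  Otherwise d = 1 by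
-- Gallai's lemma.
module Submission where

open import Defs
open import Data.Empty using (⊥; ⊥-elim)
open import Data.Fin.Base using (Fin; zero; suc; toℕ; fromℕ<)
import Data.Fin.Properties as Fin
open import Data.Fin.Subset using (Subset; _∈_; ∣_∣)
open import Data.Integer.Base using (+_)
open import Data.List.Base using (List; []; _∷_; length; filter; allFin)
open import Data.List.Membership.Propositional.Properties using (∈-filter⁺; ∈-allFin)
open import Data.List.Relation.Unary.All as All using (All; []; _∷_)
open import Data.List.Relation.Unary.All.Properties using (all-filter)
open import Data.Nat.Base as ℕ using (ℕ; zero; suc; z≤n; s≤s)
import Data.Nat.Properties as ℕ
open import Data.Nat.Tactic.RingSolver using (solve-∀)
open import Data.Product.Base using (Σ; ∃; _×_; _,_; proj₁; proj₂)
open import Data.Rational.Base using (ℚ; 0ℚ; 1ℚ; ½; _/_; _≤_; _<_; _+_; _*_; -_; _-_; positive; nonNegative)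
open import Data.Rational.Properties
open import Data.Rational.Solver using (module +-*-Solver)
open import Data.Sum.Base using (_⊎_; inj₁; inj₂; [_,_]′)
open import Data.Vec.Base using (tabulate)
open import Data.Vec.Properties using (lookup∘tabulate; []=⇒lookup)
open import Function.Base using (_∘_; id)
open import Level using (0ℓ; Level)
open import Relation.Binary.Bundles using (DecTotalOrder)
open import Relation.Binary.Definitions using (tri<; tri≈; tri>)
open import Relation.Binary.PropositionalEquality
  using (_≡_; _≢_; refl; sym; trans; cong; cong₂; subst; subst₂)
open import Relation.Nullary using (¬_; Dec; yes; no; does; contradiction; _×-dec_; _⊎-dec_; ¬?; decidable-stable)
open import Relation.Nullary.Decidable using (¬¬-excluded-middle)
open import Relation.Unary using (Pred; Decidable; U)
open import Data.List.Extrema (DecTotalOrder.totalOrder ≤-decTotalOrder) using (argmax; argmax-all; f[xs]≤f[argmax])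
open +-*-Solver using (Polynomial; solve; _:+_; _:*_; _:-_; :-_; _:=_; con)
open UnitDiskGraph using (graph)

-- Plane geometry over ℚ

-- Adjacency of real points is undecidable, but the final bound is an inequality of naturals and
-- hence stable under double negation; this is what licenses the classical case distinctions.
-- Adjacent points may be at distance exactly 1, and truncating their coordinates may push them
-- apart, so the rational model comes with a threshold `t` for squared distances that is only known
-- to be positive. The geometry then needs no square roots: a gap `q - p`, or a positive multiple of
-- it, is written as a sum of visibly nonnegative terms and the ring solver checks the identity. The
-- constant √3 is where two facts meet: unit discs with centres √3 apart intersect in a set of
-- diameter 1, and an equilateral triangle of side √3 has circumradius 1. Both reductions for |S| +
-- d ≤ 3ω(S) are exact: deleting a vertex covered by every maximum matching lowers |S| by one and
-- raises d by one, and for parts without an edge of H between them both sides are additive. The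
-- surplus 1 in |S| + 1 ≤ 3ω(S) pays for d = 1.

Pt : Set
Pt = ℚ × ℚ

sq : Pt → Pt → ℚ
sq (x , y) (x′ , y′) = (x - x′) * (x - x′) + (y - y′) * (y - y′)

p≤q⇒0≤q-p : ∀ {p q} → p ≤ q → 0ℚ ≤ q - p
p≤q⇒0≤q-p {p} {q} p≤q = subst (_≤ q - p) (+-inverseʳ p) (+-monoˡ-≤ (- p) p≤q)

0≤q-p⇒p≤q : ∀ {p q} → 0ℚ ≤ q - p → p ≤ q
0≤q-p⇒p≤q {p} {q} 0≤ = subst₂ _≤_ (+-identityˡ p)
  (solve 2 (λ p q → (q :- p) :+ p := q) refl p q) (+-monoˡ-≤ p 0≤)

0≤p*p : ∀ p → 0ℚ ≤ p * p
0≤p*p p with ≤-total 0ℚ p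
... | inj₁ 0≤p = *-nonNeg 0≤p 0≤p
... | inj₂ p≤0 = subst (0ℚ ≤_) (solve 1 (λ p → (:- p) :* (:- p) := p :* p) refl p)
                   (*-nonNeg (neg-antimono-≤ p≤0) (neg-antimono-≤ p≤0))

infixl 6 _⊕_
_⊕_ : ∀ {p q} → 0ℚ ≤ p → 0ℚ ≤ q → 0ℚ ≤ p + q
_⊕_ = +-mono-≤

infixr 7 _⊛_
_⊛_ : ∀ {p q} → 0ℚ ≤ p → 0ℚ ≤ q → 0ℚ ≤ p * q
_⊛_ = *-nonNeg

slack : ∀ {p q s} → 0ℚ ≤ s → s ≡ q - p → p ≤ q
slack 0≤s eq = 0≤q-p⇒p≤q (subst (0ℚ ≤_) eq 0≤s)

0≤sq : ∀ p q → 0ℚ ≤ sq p q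
0≤sq (x , y) (x′ , y′) = 0≤p*p (x - x′) ⊕ 0≤p*p (y - y′)

sq-sym : ∀ p q → sq p q ≡ sq q p
sq-sym (x , y) (x′ , y′) = cong₂ _+_ (square-sym x x′) (square-sym y y′)

-- By the parallelogram law, |up|² + |uq|² + |wp|² + |wq|² = |uw|² + |pq|² + |u + w - p - q|². The
-- left side is at most 4t, and |uw|² is at least 3t.
lens : ∀ {t} u w p q → t + t + t ≤ sq u w → sq u p ≤ t → sq u q ≤ t → sq w p ≤ t → sq w q ≤ t →
       sq p q ≤ t
lens {t} u@(u₁ , u₂) w@(w₁ , w₂) p@(p₁ , p₂) q@(q₁ , q₂) uw up uq wp wq =
  slack (p≤q⇒0≤q-p uw ⊕ p≤q⇒0≤q-p up ⊕ p≤q⇒0≤q-p uq ⊕ p≤q⇒0≤q-p wp ⊕ p≤q⇒0≤q-p wq ⊕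
         0≤p*p (u₁ + w₁ - p₁ - q₁) ⊕ 0≤p*p (u₂ + w₂ - p₂ - q₂))
  (solve 9 (λ t u₁ u₂ w₁ w₂ p₁ p₂ q₁ q₂ →
    let sq′ = λ x y x′ y′ → (x :- x′) :* (x :- x′) :+ (y :- y′) :* (y :- y′) in
    (sq′ u₁ u₂ w₁ w₂ :- (t :+ t :+ t)) :+ (t :- sq′ u₁ u₂ p₁ p₂) :+ (t :- sq′ u₁ u₂ q₁ q₂)
     :+ (t :- sq′ w₁ w₂ p₁ p₂) :+ (t :- sq′ w₁ w₂ q₁ q₂)
     :+ (u₁ :+ w₁ :- p₁ :- q₁) :* (u₁ :+ w₁ :- p₁ :- q₁)
     :+ (u₂ :+ w₂ :- p₂ :- q₂) :* (u₂ :+ w₂ :- p₂ :- q₂)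
     := t :- sq′ p₁ p₂ q₁ q₂) refl t u₁ u₂ w₁ w₂ p₁ p₂ q₁ q₂)

0≤fraction : ∀ m n → 0ℚ ≤ + m / suc n
0≤fraction m n = *-cancelʳ-≤-pos (fromℕ (suc n)) {{positive (0<fromℕ-suc n)}}
  (subst₂ _≤_ (sym (*-zeroˡ (fromℕ (suc n)))) (sym (/-*-cancel m n)) (0≤fromℕ m))

sqᴾ : ∀ {n} (x y x′ y′ : Polynomial n) → Polynomial n
sqᴾ x y x′ y′ = (x :- x′) :* (x :- x′) :+ (y :- y′) :* (y :- y′)

nat : ∀ {n} → ℕ → Polynomial n
nat k = con (fromℕ k)

-- The weight 1/7 bounds the squared distances from the centre to p, q and r
-- by 45/49, 40/49 and 48/49 of t.
narrow-triangle : ∀ {t} p q r → sq p q ≤ t → sq q r ≤ t + t + t → sq p r ≤ sq q r →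
                  ∃ λ o → sq o p ≤ t × sq o q ≤ t × sq o r ≤ t
narrow-triangle {t} p@(p₁ , p₂) q@(q₁ , q₂) r@(r₁ , r₂) pq≤t qr≤3t pr≤qr =
  (centre p₁ q₁ r₁ , centre p₂ q₂ r₂)
  , slack (0≤/49 ⊛ (0≤fromℕ 4 ⊛ 0≤t ⊕ 0≤fromℕ 18 ⊛ c ⊕ 0≤fromℕ 9 ⊛ a ⊕ 0≤fromℕ 18 ⊛ b))
      (solve 7 (λ t p₁ p₂ q₁ q₂ r₁ r₂ →
        con (+ 1 / 49) :* (nat 4 :* t :+ nat 18 :* (t :- sqᴾ p₁ p₂ q₁ q₂)
          :+ nat 9 :* (t :+ t :+ t :- sqᴾ q₁ q₂ r₁ r₂) :+ nat 18 :* (sqᴾ q₁ q₂ r₁ r₂ :- sqᴾ p₁ p₂ r₁ r₂))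
        := t :- sqᴾ (centreᴾ p₁ q₁ r₁) (centreᴾ p₂ q₂ r₂) p₁ p₂) refl t p₁ p₂ q₁ q₂ r₁ r₂)
  , slack (0≤/49 ⊛ (0≤fromℕ 9 ⊛ 0≤t ⊕ 0≤fromℕ 4 ⊛ c ⊕ 0≤fromℕ 12 ⊛ a ⊕ 0≤fromℕ 3 ⊛ 0≤sq p r))
      (solve 7 (λ t p₁ p₂ q₁ q₂ r₁ r₂ →
        con (+ 1 / 49) :* (nat 9 :* t :+ nat 4 :* (t :- sqᴾ p₁ p₂ q₁ q₂)
          :+ nat 12 :* (t :+ t :+ t :- sqᴾ q₁ q₂ r₁ r₂) :+ nat 3 :* sqᴾ p₁ p₂ r₁ r₂)
        := t :- sqᴾ (centreᴾ p₁ q₁ r₁) (centreᴾ p₂ q₂ r₂) q₁ q₂) refl t p₁ p₂ q₁ q₂ r₁ r₂)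
  , slack (0≤/49 ⊛ (0≤t ⊕ 0≤fromℕ 16 ⊛ a ⊕ 0≤fromℕ 4 ⊛ b ⊕ 0≤fromℕ 3 ⊛ 0≤sq p q))
      (solve 7 (λ t p₁ p₂ q₁ q₂ r₁ r₂ →
        con (+ 1 / 49) :* (t :+ nat 16 :* (t :+ t :+ t :- sqᴾ q₁ q₂ r₁ r₂)
          :+ nat 4 :* (sqᴾ q₁ q₂ r₁ r₂ :- sqᴾ p₁ p₂ r₁ r₂) :+ nat 3 :* sqᴾ p₁ p₂ q₁ q₂)
        := t :- sqᴾ (centreᴾ p₁ q₁ r₁) (centreᴾ p₂ q₂ r₂) r₁ r₂) refl t p₁ p₂ q₁ q₂ r₁ r₂)
  where
  centre : ℚ → ℚ → ℚ → ℚ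
  centre x y z = (+ 1 / 7) * (x + fromℕ 3 * y + fromℕ 3 * z)
  centreᴾ : ∀ {n} (x y z : Polynomial n) → Polynomial n
  centreᴾ x y z = con (+ 1 / 7) :* (x :+ nat 3 :* y :+ nat 3 :* z)
  0≤/49 = 0≤fraction 1 48
  0≤t = ≤-trans (0≤sq p q) pq≤t
  c = p≤q⇒0≤q-p pq≤t
  a = p≤q⇒0≤q-p qr≤3t
  b = p≤q⇒0≤q-p pr≤qr

infix 8 _·_ _∧_ ∥_∥²
_·_ _∧_ : Pt → Pt → ℚ
(x , y) · (x′ , y′) = x * x′ + y * y′
(x , y) ∧ (x′ , y′) = x * y′ - y * x′

∥_∥² : Pt → ℚ
∥ p ∥² = p · p

dotᴾ : ∀ {n} (x y x′ y′ : Polynomial n) → Polynomial n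
dotᴾ x y x′ y′ = x :* x′ :+ y :* y′
wedgeᴾ : ∀ {n} (x y x′ y′ : Polynomial n) → Polynomial n
wedgeᴾ x y x′ y′ = x :* y′ :- y :* x′

0≤∥∥² : ∀ p → 0ℚ ≤ ∥ p ∥²
0≤∥∥² (x , y) = 0≤p*p x ⊕ 0≤p*p y

scaled-slack : ∀ {p q k s} → 0ℚ < k → 0ℚ ≤ s → s ≡ k * (q - p) → p ≤ q
scaled-slack {p} {q} {k} 0<k 0≤s eq = 0≤q-p⇒p≤q (*-cancelˡ-≤-pos k {{positive 0<k}}
  (subst₂ _≤_ (sym (*-zeroʳ k)) eq 0≤s))

-- Diameter of half of a lens

module HalfLens {t : ℚ} (0≤t : 0ℚ ≤ t) where

  -- The vertex v is the origin and `o` the centre. The second inequality is |o - p|² ≤ |o|²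
  -- expanded: `p` is no farther from `o` than the origin is.
  InLens : Pt → Pt → Set
  InLens o p = ∥ p ∥² ≤ t × ∥ p ∥² ≤ o · p + o · p

  -- The degenerate lens, where no line through `o` and the origin is determined. The parallelogram
  -- law for `p - o` and `q - o` settles it without deducing that the points vanish.
  point : ∀ o p q → ∥ o ∥² ≤ 0ℚ → InLens o p → InLens o q → sq p q ≤ t
  point o@(o₁ , o₂) p@(p₁ , p₂) q@(q₁ , q₂) o≤0 (_ , p≤) (_ , q≤) =
    slack (0≤t ⊕ 0≤p*p (p₁ + q₁ - (o₁ + o₁)) ⊕ 0≤p*p (p₂ + q₂ - (o₂ + o₂))
           ⊕ 0≤fromℕ 2 ⊛ p≤q⇒0≤q-p p≤ ⊕ 0≤fromℕ 2 ⊛ p≤q⇒0≤q-p q≤ ⊕ 0≤fromℕ 4 ⊛ p≤q⇒0≤q-p o≤0)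
    (solve 7 (λ t o₁ o₂ p₁ p₂ q₁ q₂ →
      t :+ (p₁ :+ q₁ :- (o₁ :+ o₁)) :* (p₁ :+ q₁ :- (o₁ :+ o₁))
        :+ (p₂ :+ q₂ :- (o₂ :+ o₂)) :* (p₂ :+ q₂ :- (o₂ :+ o₂))
        :+ nat 2 :* (dotᴾ o₁ o₂ p₁ p₂ :+ dotᴾ o₁ o₂ p₁ p₂ :- dotᴾ p₁ p₂ p₁ p₂)
        :+ nat 2 :* (dotᴾ o₁ o₂ q₁ q₂ :+ dotᴾ o₁ o₂ q₁ q₂ :- dotᴾ q₁ q₂ q₁ q₂)
        :+ nat 4 :* (nat 0 :- dotᴾ o₁ o₂ o₁ o₂)
      := t :- sqᴾ p₁ p₂ q₁ q₂) refl t o₁ o₂ p₁ p₂ q₁ q₂)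

  0≤dot : ∀ o p → InLens o p → 0ℚ ≤ o · p
  0≤dot o@(o₁ , o₂) p@(p₁ , p₂) (_ , p≤) = slack (0≤fraction 1 1 ⊛ (0≤∥∥² p ⊕ p≤q⇒0≤q-p p≤))
    (solve 4 (λ o₁ o₂ p₁ p₂ →
      con (+ 1 / 2) :* (dotᴾ p₁ p₂ p₁ p₂
         :+ (dotᴾ o₁ o₂ p₁ p₂ :+ dotᴾ o₁ o₂ p₁ p₂ :- dotᴾ p₁ p₂ p₁ p₂))
      := dotᴾ o₁ o₂ p₁ p₂ :- nat 0) refl o₁ o₂ p₁ p₂)

  -- Certificates are polynomial identities and cannot use that `o ∧ q` vanishes, so its multiples
  -- occur in them as extra terms, nonnegative for this reason.
  null : ∀ {k} x → k ≡ 0ℚ → 0ℚ ≤ k * x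
  null x refl = ≤-reflexive (sym (*-zeroˡ x))

  collinear : ∀ o p q → 0ℚ < ∥ o ∥² → ∥ o ∥² ≤ t → o ∧ q ≡ 0ℚ → InLens o p → InLens o q → sq p q ≤ t
  collinear o@(o₁ , o₂) p@(p₁ , p₂) q@(q₁ , q₂) 0<N N≤t κ≡0 (p≤t , p≤) q∈@(q≤t , q≤)
    with ≤-total (o · q) ∥ o ∥²
  -- `q` lies on the segment from the origin to `o`. Both ends are within √t of `p`, so convexity
  -- applies.
  ... | inj₁ g≤N = scaled-slack (*-pos 0<N 0<N)
          (0≤N ⊛ 0≤g ⊛ p≤q⇒0≤q-p p≤ ⊕ 0≤N ⊛ p≤q⇒0≤q-p g≤N ⊛ p≤q⇒0≤q-p p≤t
            ⊕ 0≤N ⊛ 0≤g ⊛ (p≤q⇒0≤q-p N≤t ⊕ p≤q⇒0≤q-p g≤N)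
            ⊕ null (∥ o ∥² * (o ∧ p + o ∧ p - o ∧ q)) κ≡0)
          (solve 7 (λ t o₁ o₂ p₁ p₂ q₁ q₂ →
            let N = dotᴾ o₁ o₂ o₁ o₂ ; g = dotᴾ o₁ o₂ q₁ q₂ ; κ = wedgeᴾ o₁ o₂ q₁ q₂
                op = dotᴾ o₁ o₂ p₁ p₂ ; pp = dotᴾ p₁ p₂ p₁ p₂ ; o∧p = wedgeᴾ o₁ o₂ p₁ p₂ in
            N :* (g :* (op :+ op :- pp)) :+ N :* ((N :- g) :* (t :- pp))
              :+ N :* (g :* ((t :- N) :+ (N :- g))) :+ κ :* (N :* (o∧p :+ o∧p :- κ))
            := (N :* N) :* (t :- sqᴾ p₁ p₂ q₁ q₂)) refl t o₁ o₂ p₁ p₂ q₁ q₂)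
    where
    0≤N = <⇒≤ 0<N
    0≤g = 0≤dot o q q∈
  -- `q` lies on the ray beyond `o`, so the disc about `q` through the origin contains the one about
  -- `o`: |p - q| ≤ |q|.
  ... | inj₂ N≤g = scaled-slack 0<N
          (<⇒≤ 0<N ⊛ p≤q⇒0≤q-p q≤t ⊕ 0≤dot o q q∈ ⊛ p≤q⇒0≤q-p p≤ ⊕ p≤q⇒0≤q-p N≤g ⊛ 0≤∥∥² p
            ⊕ null (o ∧ p + o ∧ p) κ≡0)
          (solve 7 (λ t o₁ o₂ p₁ p₂ q₁ q₂ →
            let N = dotᴾ o₁ o₂ o₁ o₂ ; g = dotᴾ o₁ o₂ q₁ q₂ ; κ = wedgeᴾ o₁ o₂ q₁ q₂
                op = dotᴾ o₁ o₂ p₁ p₂ ; pp = dotᴾ p₁ p₂ p₁ p₂ ; o∧p = wedgeᴾ o₁ o₂ p₁ p₂ in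
            N :* (t :- dotᴾ q₁ q₂ q₁ q₂) :+ g :* (op :+ op :- pp) :+ (g :- N) :* pp
              :+ κ :* (o∧p :+ o∧p)
            := N :* (t :- sqᴾ p₁ p₂ q₁ q₂)) refl t o₁ o₂ p₁ p₂ q₁ q₂)

  -- With κ = o ∧ q, A = p ∧ q and B = o ∧ p, Cramer's rule reads κ p = A o + B q.
  cone : ∀ o p q → 0ℚ < o ∧ q → 0ℚ ≤ p ∧ q → 0ℚ ≤ o ∧ p → ∥ o ∥² ≤ t →
         InLens o p → InLens o q → sq p q ≤ t
  cone o@(o₁ , o₂) p@(p₁ , p₂) q@(q₁ , q₂) 0<κ 0≤A 0≤B N≤t (p≤t , _) (q≤t , q≤)
    with ≤-total (o ∧ q) (p ∧ q + (o ∧ p + o ∧ p))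
  -- Cramer's rule and 2 (o · q) ≥ |q|² give 2 (p · q) ≥ |q|², that is |p - q| ≤ |p|.
  ... | inj₁ κ≤ = scaled-slack 0<κ
          (<⇒≤ 0<κ ⊛ p≤q⇒0≤q-p p≤t ⊕ 0≤A ⊛ p≤q⇒0≤q-p q≤ ⊕ p≤q⇒0≤q-p κ≤ ⊛ 0≤∥∥² q)
          (solve 7 (λ t o₁ o₂ p₁ p₂ q₁ q₂ →
            let κ = wedgeᴾ o₁ o₂ q₁ q₂ ; A = wedgeᴾ p₁ p₂ q₁ q₂ ; B = wedgeᴾ o₁ o₂ p₁ p₂
                oq = dotᴾ o₁ o₂ q₁ q₂ ; qq = dotᴾ q₁ q₂ q₁ q₂ in
            κ :* (t :- dotᴾ p₁ p₂ p₁ p₂) :+ A :* (oq :+ oq :- qq) :+ (A :+ (B :+ B) :- κ) :* qq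
            := κ :* (t :- sqᴾ p₁ p₂ q₁ q₂)) refl t o₁ o₂ p₁ p₂ q₁ q₂)
  -- Here κ (p - q) = A o - (κ - B) q. Its squared length is at most t (A² + (κ - B)(κ - A - B)),
  -- which is at most κ² t.
  ... | inj₂ ≤κ = scaled-slack (*-pos 0<κ 0<κ)
          (0≤A ⊛ 0≤κ-B ⊛ p≤q⇒0≤q-p q≤ ⊕ 0≤κ-B ⊛ 0≤κ-A-B ⊛ p≤q⇒0≤q-p q≤t
            ⊕ 0≤A ⊛ 0≤A ⊛ p≤q⇒0≤q-p N≤t ⊕ 0≤t ⊛ (0≤A ⊛ 0≤κ-A-B ⊕ 0≤B ⊛ (0≤κ-B ⊕ <⇒≤ 0<κ)))
          (trans (abstract-form t A B κ o₁ o₂ q₁ q₂)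
            (trans (cong₂ (λ r₁ r₂ → κ * κ * t - (r₁ * r₁ + r₂ * r₂)) (cramer₁ o₁ o₂ p₁ p₂ q₁ q₂) (cramer₂ o₁ o₂ p₁ p₂ q₁ q₂))
              (solve 6 (λ t κ p₁ p₂ q₁ q₂ → 
                κ :* κ :* t :- ((κ :* (p₁ :- q₁)) :* (κ :* (p₁ :- q₁)) :+ (κ :* (p₂ :- q₂)) :* (κ :* (p₂ :- q₂)))
                := (κ :* κ) :* (t :- sqᴾ p₁ p₂ q₁ q₂)) refl t κ p₁ p₂ q₁ q₂)))
    where
    κ = o ∧ q
    A = p ∧ q
    B = o ∧ p
    0≤κ-B : 0ℚ ≤ κ - B
    0≤κ-B = slack (p≤q⇒0≤q-p ≤κ ⊕ 0≤A ⊕ 0≤B) (solve 3 (λ κ A B →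
      κ :- (A :+ (B :+ B)) :+ A :+ B := (κ :- B) :- nat 0) refl κ A B)
    0≤κ-A-B : 0ℚ ≤ κ - A - B
    0≤κ-A-B = slack (p≤q⇒0≤q-p ≤κ ⊕ 0≤B) (solve 3 (λ κ A B →
      κ :- (A :+ (B :+ B)) :+ B := (κ :- A :- B) :- nat 0) refl κ A B)
    abstract-form = solve 8 (λ t A B κ o₁ o₂ q₁ q₂ →
      let oo = dotᴾ o₁ o₂ o₁ o₂ ; oq = dotᴾ o₁ o₂ q₁ q₂ ; qq = dotᴾ q₁ q₂ q₁ q₂
          r₁ = A :* o₁ :- (κ :- B) :* q₁ ; r₂ = A :* o₂ :- (κ :- B) :* q₂ in
      A :* ((κ :- B) :* (oq :+ oq :- qq)) :+ (κ :- B) :* ((κ :- A :- B) :* (t :- qq))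
        :+ A :* (A :* (t :- oo)) :+ t :* (A :* (κ :- A :- B) :+ B :* (κ :- B :+ κ))
      := κ :* κ :* t :- (r₁ :* r₁ :+ r₂ :* r₂)) refl
    cramer₁ = solve 6 (λ o₁ o₂ p₁ p₂ q₁ q₂ →
      wedgeᴾ p₁ p₂ q₁ q₂ :* o₁ :- (wedgeᴾ o₁ o₂ q₁ q₂ :- wedgeᴾ o₁ o₂ p₁ p₂) :* q₁
      := wedgeᴾ o₁ o₂ q₁ q₂ :* (p₁ :- q₁)) refl
    cramer₂ = solve 6 (λ o₁ o₂ p₁ p₂ q₁ q₂ →
      wedgeᴾ p₁ p₂ q₁ q₂ :* o₂ :- (wedgeᴾ o₁ o₂ q₁ q₂ :- wedgeᴾ o₁ o₂ p₁ p₂) :* q₂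
      := wedgeᴾ o₁ o₂ q₁ q₂ :* (p₂ :- q₂)) refl

  private
    0≤wedge-flip : ∀ p q → p ∧ q ≤ 0ℚ → 0ℚ ≤ q ∧ p
    0≤wedge-flip (p₁ , p₂) (q₁ , q₂) p∧q≤0 = slack (p≤q⇒0≤q-p p∧q≤0)
      (solve 4 (λ p₁ p₂ q₁ q₂ → nat 0 :- wedgeᴾ p₁ p₂ q₁ q₂ := wedgeᴾ q₁ q₂ p₁ p₂ :- nat 0) refl p₁ p₂ q₁ q₂)

  sorted : ∀ o p q → 0ℚ < ∥ o ∥² → 0ℚ ≤ o ∧ p → 0ℚ ≤ o ∧ q → 0ℚ ≤ p ∧ q → ∥ o ∥² ≤ t →
           InLens o p → InLens o q → sq p q ≤ t
  sorted o p q 0<N 0≤B 0≤κ 0≤A N≤t p∈ q∈ with o ∧ q ≤? 0ℚ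
  ... | yes κ≤0 = collinear o p q 0<N N≤t (≤-antisym κ≤0 0≤κ) p∈ q∈
  ... | no  κ≰0 = cone o p q (≰⇒> κ≰0) 0≤A 0≤B N≤t p∈ q∈

  upper : ∀ o p q → ∥ o ∥² ≤ t → 0ℚ ≤ o ∧ p → 0ℚ ≤ o ∧ q → InLens o p → InLens o q → sq p q ≤ t
  upper o p q N≤t 0≤p 0≤q p∈ q∈ with ∥ o ∥² ≤? 0ℚ | ≤-total 0ℚ (p ∧ q)
  ... | yes N≤0 | _ = point o p q N≤0 p∈ q∈
  ... | no  N≰0 | inj₁ 0≤A = sorted o p q (≰⇒> N≰0) 0≤p 0≤q 0≤A N≤t p∈ q∈
  ... | no  N≰0 | inj₂ A≤0 = subst (_≤ t) (sq-sym q p)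
                               (sorted o q p (≰⇒> N≰0) 0≤q 0≤p (0≤wedge-flip p q A≤0) N≤t q∈ p∈)

-- Radon points and Helly's theorem for discs of equal radius

weighted : ℚ → ℚ → ℚ → ℚ → Pt → Pt → Pt → Pt → Pt
weighted w₁ w₂ w₃ w₄ (x₁ , y₁) (x₂ , y₂) (x₃ , y₃) (x₄ , y₄) =
  w₁ * x₁ + w₂ * x₂ + w₃ * x₃ + w₄ * x₄ , w₁ * y₁ + w₂ * y₂ + w₃ * y₃ + w₄ * y₄

-- Jensen's inequality for the squared distance to p; a point of zero weight need not satisfy the bound.
jensen : ∀ {t w₁ w₂ w₃ w₄} p o₁ o₂ o₃ o₄ → 0ℚ ≤ w₁ → 0ℚ ≤ w₂ → 0ℚ ≤ w₃ → 0ℚ ≤ w₄ →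
         w₁ + w₂ + w₃ + w₄ ≡ 1ℚ →
         w₁ ≡ 0ℚ ⊎ sq o₁ p ≤ t → w₂ ≡ 0ℚ ⊎ sq o₂ p ≤ t →
         w₃ ≡ 0ℚ ⊎ sq o₃ p ≤ t → w₄ ≡ 0ℚ ⊎ sq o₄ p ≤ t →
         sq (weighted w₁ w₂ w₃ w₄ o₁ o₂ o₃ o₄) p ≤ t
jensen {t} {w₁} {w₂} {w₃} {w₄} p@(p₁ , p₂) o₁@(x₁ , y₁) o₂@(x₂ , y₂) o₃@(x₃ , y₃) o₄@(x₄ , y₄)
       0≤w₁ 0≤w₂ 0≤w₃ 0≤w₄ ∑w≡1 c₁ c₂ c₃ c₄ =
  slack (term o₁ 0≤w₁ c₁ ⊕ term o₂ 0≤w₂ c₂ ⊕ term o₃ 0≤w₃ c₃ ⊕ term o₄ 0≤w₄ c₄)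
    (trans (affine K d₁ d₂ w₁ w₂ w₃ w₄ x₁ x₂ x₃ x₄ y₁ y₂ y₃ y₄)
      (trans (cong (λ W → W * K - (d₁ * X + d₂ * Y) - (d₁ * X + d₂ * Y)) ∑w≡1)
        (solve 5 (λ t X Y p₁ p₂ →
          let d₁ = X :- p₁ ; d₂ = Y :- p₂ ; dot = d₁ :* X :+ d₂ :* Y in
          con 1ℚ :* (t :+ (d₁ :* (X :+ p₁) :+ d₂ :* (Y :+ p₂))) :- dot :- dot
          := t :- sqᴾ X Y p₁ p₂) refl t X Y p₁ p₂)))
  where
  o = weighted w₁ w₂ w₃ w₄ o₁ o₂ o₃ o₄
  X = proj₁ o
  Y = proj₂ o
  d₁ = X - p₁
  d₂ = Y - p₂
  -- With d = o - p and `K` = t + |o|² - |p|², the sum t - |u - p|² + |u - o|² equals K - 2 (d · u).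
  -- Being affine in u, its weighted mean over the four points is its value t - |o - p|² at `o`.
  K = t + (d₁ * (X + p₁) + d₂ * (Y + p₂))
  bound : ∀ {w} u → 0ℚ ≤ w → w ≡ 0ℚ ⊎ sq u p ≤ t → 0ℚ ≤ w * (t - sq u p)
  bound u 0≤w (inj₁ refl) = ≤-reflexive (sym (*-zeroˡ (t - sq u p)))
  bound u 0≤w (inj₂ u≤t) = 0≤w ⊛ p≤q⇒0≤q-p u≤t
  term : ∀ {w} u → 0ℚ ≤ w → w ≡ 0ℚ ⊎ sq u p ≤ t →
         0ℚ ≤ w * (K - (d₁ * proj₁ u + d₂ * proj₂ u) - (d₁ * proj₁ u + d₂ * proj₂ u))
  term {w} u@(x , y) 0≤w c = subst (0ℚ ≤_)
    (solve 8 (λ t w X Y p₁ p₂ x y →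
      let d₁ = X :- p₁ ; d₂ = Y :- p₂ ; dot = d₁ :* x :+ d₂ :* y in
      w :* (t :- sqᴾ x y p₁ p₂) :+ w :* sqᴾ x y X Y
      := w :* (t :+ (d₁ :* (X :+ p₁) :+ d₂ :* (Y :+ p₂)) :- dot :- dot)) refl t w X Y p₁ p₂ x y)
    (bound u 0≤w c ⊕ 0≤w ⊛ 0≤sq u o)
  affine = solve 15 (λ K d₁ d₂ w₁ w₂ w₃ w₄ x₁ x₂ x₃ x₄ y₁ y₂ y₃ y₄ →
    let t = λ w x y → w :* (K :- (d₁ :* x :+ d₂ :* y) :- (d₁ :* x :+ d₂ :* y))
        X = w₁ :* x₁ :+ w₂ :* x₂ :+ w₃ :* x₃ :+ w₄ :* x₄
        Y = w₁ :* y₁ :+ w₂ :* y₂ :+ w₃ :* y₃ :+ w₄ :* y₄ in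
    t w₁ x₁ y₁ :+ t w₂ x₂ y₂ :+ t w₃ x₃ y₃ :+ t w₄ x₄ y₄
    := (w₁ :+ w₂ :+ w₃ :+ w₄) :* K :- (d₁ :* X :+ d₂ :* Y) :- (d₁ :* X :+ d₂ :* Y)) refl

-- Radon's theorem puts `o` into the convex hulls of two disjoint blocks of the four points. Each
-- index is outside one of the blocks, so a disc about `p` containing the three other points
-- contains `o`. Helly's theorem needs only this consequence.
RadonPoint : Pt → Pt → Pt → Pt → Pt → Set
RadonPoint o o₁ o₂ o₃ o₄ = ∀ {t} p →
    (sq o₂ p ≤ t → sq o₃ p ≤ t → sq o₄ p ≤ t → sq o p ≤ t)
  × (sq o₁ p ≤ t → sq o₃ p ≤ t → sq o₄ p ≤ t → sq o p ≤ t)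
  × (sq o₁ p ≤ t → sq o₂ p ≤ t → sq o₄ p ≤ t → sq o p ≤ t)
  × (sq o₁ p ≤ t → sq o₂ p ≤ t → sq o₃ p ≤ t → sq o p ≤ t)

signed-parts : ∀ p → ∃ λ p⁺ → ∃ λ p⁻ → 0ℚ ≤ p⁺ × 0ℚ ≤ p⁻ × p ≡ p⁺ - p⁻ × (p⁺ ≡ 0ℚ ⊎ p⁻ ≡ 0ℚ)
signed-parts p with ≤-total 0ℚ p
... | inj₁ 0≤p = p , 0ℚ , 0≤p , ≤-refl , sym (+-identityʳ p) , inj₂ refl
... | inj₂ p≤0 = 0ℚ , - p , ≤-refl , neg-antimono-≤ p≤0
                 , solve 1 (λ p → p := con 0ℚ :- (:- p)) refl p , inj₁ refl

-- The affine dependence `l` is split into its positive and negative parts `a` and `b`, which have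
-- equal sums and equal weighted sums. Divided by the sum `s`, which `0ℚ < l₁` makes positive, they
-- are two convex combinations for one point, and any given index has weight 0 in one of them.
radon⁺ : ∀ {l₁ l₂ l₃ l₄} o₁ o₂ o₃ o₄ → 0ℚ < l₁ → l₁ + l₂ + l₃ + l₄ ≡ 0ℚ →
         weighted l₁ l₂ l₃ l₄ o₁ o₂ o₃ o₄ ≡ (0ℚ , 0ℚ) → ∃ λ o → RadonPoint o o₁ o₂ o₃ o₄
radon⁺ {l₁} {l₂} {l₃} {l₄} o₁@(x₁ , y₁) o₂@(x₂ , y₂) o₃@(x₃ , y₃) o₄@(x₄ , y₄) 0<l₁ ∑l≡0 ∑lo≡0
  with signed-parts l₁ | signed-parts l₂ | signed-parts l₃ | signed-parts l₄
... | a₁ , b₁ , 0≤a₁ , 0≤b₁ , refl , z₁ | a₂ , b₂ , 0≤a₂ , 0≤b₂ , refl , z₂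
    | a₃ , b₃ , 0≤a₃ , 0≤b₃ , refl , z₃ | a₄ , b₄ , 0≤a₄ , 0≤b₄ , refl , z₄ =
  a·o , λ p →
    (λ h₂ h₃ h₄ → close z₁ (λ z → by-a p (inj₁ z) (inj₂ h₂) (inj₂ h₃) (inj₂ h₄))
                           (λ z → by-b p (inj₁ z) (inj₂ h₂) (inj₂ h₃) (inj₂ h₄)))
  , (λ h₁ h₃ h₄ → close z₂ (λ z → by-a p (inj₂ h₁) (inj₁ z) (inj₂ h₃) (inj₂ h₄))
                           (λ z → by-b p (inj₂ h₁) (inj₁ z) (inj₂ h₃) (inj₂ h₄)))
  , (λ h₁ h₂ h₄ → close z₃ (λ z → by-a p (inj₂ h₁) (inj₂ h₂) (inj₁ z) (inj₂ h₄))
                           (λ z → by-b p (inj₂ h₁) (inj₂ h₂) (inj₁ z) (inj₂ h₄)))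
  , (λ h₁ h₂ h₃ → close z₄ (λ z → by-a p (inj₂ h₁) (inj₂ h₂) (inj₂ h₃) (inj₁ z))
                           (λ z → by-b p (inj₂ h₁) (inj₂ h₂) (inj₂ h₃) (inj₁ z)))
  where
  s = a₁ + a₂ + a₃ + a₄
  0<s : 0ℚ < s
  0<s = <-≤-trans 0<l₁ (slack (0≤b₁ ⊕ 0≤a₂ ⊕ 0≤a₃ ⊕ 0≤a₄)
    (solve 5 (λ a₁ b₁ a₂ a₃ a₄ → b₁ :+ a₂ :+ a₃ :+ a₄ := a₁ :+ a₂ :+ a₃ :+ a₄ :- (a₁ :- b₁))
      refl a₁ b₁ a₂ a₃ a₄))
  σ = proj₁ (divide 0<s (positive⁻¹ 1ℚ))
  0≤σ = <⇒≤ (proj₁ (proj₂ (divide 0<s (positive⁻¹ 1ℚ))))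
  sσ≡1 : s * σ ≡ 1ℚ
  sσ≡1 = proj₂ (proj₂ (divide 0<s (positive⁻¹ 1ℚ)))
  a·o = weighted (a₁ * σ) (a₂ * σ) (a₃ * σ) (a₄ * σ) o₁ o₂ o₃ o₄
  b·o = weighted (b₁ * σ) (b₂ * σ) (b₃ * σ) (b₄ * σ) o₁ o₂ o₃ o₄
  normal : ∀ c₁ c₂ c₃ c₄ → c₁ + c₂ + c₃ + c₄ ≡ s → c₁ * σ + c₂ * σ + c₃ * σ + c₄ * σ ≡ 1ℚ
  normal c₁ c₂ c₃ c₄ eq = trans
    (solve 5 (λ σ c₁ c₂ c₃ c₄ → c₁ :* σ :+ c₂ :* σ :+ c₃ :* σ :+ c₄ :* σ
                             := (c₁ :+ c₂ :+ c₃ :+ c₄) :* σ) refl σ c₁ c₂ c₃ c₄)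
    (trans (cong (_* σ) eq) sσ≡1)
  ∑b≡s : b₁ + b₂ + b₃ + b₄ ≡ s
  ∑b≡s = trans
    (solve 8 (λ a₁ a₂ a₃ a₄ b₁ b₂ b₃ b₄ → b₁ :+ b₂ :+ b₃ :+ b₄
      := a₁ :+ a₂ :+ a₃ :+ a₄ :- (a₁ :- b₁ :+ (a₂ :- b₂) :+ (a₃ :- b₃) :+ (a₄ :- b₄)))
      refl a₁ a₂ a₃ a₄ b₁ b₂ b₃ b₄)
    (trans (cong (λ z → s - z) ∑l≡0) (+-identityʳ s))
  coordinate : ∀ x₁ x₂ x₃ x₄ →
    (a₁ - b₁) * x₁ + (a₂ - b₂) * x₂ + (a₃ - b₃) * x₃ + (a₄ - b₄) * x₄ ≡ 0ℚ →
    (b₁ * σ) * x₁ + (b₂ * σ) * x₂ + (b₃ * σ) * x₃ + (b₄ * σ) * x₄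
    ≡ (a₁ * σ) * x₁ + (a₂ * σ) * x₂ + (a₃ * σ) * x₃ + (a₄ * σ) * x₄
  coordinate x₁ x₂ x₃ x₄ eq = trans
    (solve 13 (λ σ a₁ a₂ a₃ a₄ b₁ b₂ b₃ b₄ x₁ x₂ x₃ x₄ →
      (b₁ :* σ) :* x₁ :+ (b₂ :* σ) :* x₂ :+ (b₃ :* σ) :* x₃ :+ (b₄ :* σ) :* x₄
      := (a₁ :* σ) :* x₁ :+ (a₂ :* σ) :* x₂ :+ (a₃ :* σ) :* x₃ :+ (a₄ :* σ) :* x₄
         :- σ :* ((a₁ :- b₁) :* x₁ :+ (a₂ :- b₂) :* x₂ :+ (a₃ :- b₃) :* x₃ :+ (a₄ :- b₄) :* x₄))
      refl σ a₁ a₂ a₃ a₄ b₁ b₂ b₃ b₄ x₁ x₂ x₃ x₄)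
    (trans (cong (λ z → a - σ * z) eq) (solve 2 (λ a σ → a :- σ :* con 0ℚ := a) refl a σ))
    where a = (a₁ * σ) * x₁ + (a₂ * σ) * x₂ + (a₃ * σ) * x₃ + (a₄ * σ) * x₄
  b·o≡a·o : b·o ≡ a·o
  b·o≡a·o = cong₂ _,_ (coordinate x₁ x₂ x₃ x₄ (cong proj₁ ∑lo≡0))
                      (coordinate y₁ y₂ y₃ y₄ (cong proj₂ ∑lo≡0))
  scaled-zero : ∀ {c} {A : Set} → c ≡ 0ℚ ⊎ A → c * σ ≡ 0ℚ ⊎ A
  scaled-zero (inj₁ refl) = inj₁ (*-zeroˡ σ)
  scaled-zero (inj₂ h) = inj₂ h
  by-a : ∀ {t} p → a₁ ≡ 0ℚ ⊎ sq o₁ p ≤ t → a₂ ≡ 0ℚ ⊎ sq o₂ p ≤ t →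
         a₃ ≡ 0ℚ ⊎ sq o₃ p ≤ t → a₄ ≡ 0ℚ ⊎ sq o₄ p ≤ t → sq a·o p ≤ t
  by-a p c₁ c₂ c₃ c₄ = jensen p o₁ o₂ o₃ o₄ (0≤a₁ ⊛ 0≤σ) (0≤a₂ ⊛ 0≤σ) (0≤a₃ ⊛ 0≤σ) (0≤a₄ ⊛ 0≤σ)
    (normal a₁ a₂ a₃ a₄ refl) (scaled-zero c₁) (scaled-zero c₂) (scaled-zero c₃) (scaled-zero c₄)
  by-b : ∀ {t} p → b₁ ≡ 0ℚ ⊎ sq o₁ p ≤ t → b₂ ≡ 0ℚ ⊎ sq o₂ p ≤ t →
         b₃ ≡ 0ℚ ⊎ sq o₃ p ≤ t → b₄ ≡ 0ℚ ⊎ sq o₄ p ≤ t → sq a·o p ≤ t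
  by-b {t} p c₁ c₂ c₃ c₄ = subst (λ o → sq o p ≤ t) b·o≡a·o
    (jensen p o₁ o₂ o₃ o₄ (0≤b₁ ⊛ 0≤σ) (0≤b₂ ⊛ 0≤σ) (0≤b₃ ⊛ 0≤σ) (0≤b₄ ⊛ 0≤σ)
      (normal b₁ b₂ b₃ b₄ ∑b≡s) (scaled-zero c₁) (scaled-zero c₂) (scaled-zero c₃) (scaled-zero c₄))
  close : ∀ {x y} {A : Set} → x ≡ 0ℚ ⊎ y ≡ 0ℚ → (x ≡ 0ℚ → A) → (y ≡ 0ℚ → A) → A
  close (inj₁ z) f g = f z
  close (inj₂ z) f g = g z

radon≢0 : ∀ {l₁ l₂ l₃ l₄} o₁ o₂ o₃ o₄ → l₁ ≢ 0ℚ → l₁ + l₂ + l₃ + l₄ ≡ 0ℚ →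
         weighted l₁ l₂ l₃ l₄ o₁ o₂ o₃ o₄ ≡ (0ℚ , 0ℚ) → ∃ λ o → RadonPoint o o₁ o₂ o₃ o₄
radon≢0 {l₁} {l₂} {l₃} {l₄} o₁@(x₁ , y₁) o₂@(x₂ , y₂) o₃@(x₃ , y₃) o₄@(x₄ , y₄) l₁≢0 ∑l≡0 ∑lo≡0
  with <-cmp 0ℚ l₁
... | tri< 0<l₁ _ _ = radon⁺ o₁ o₂ o₃ o₄ 0<l₁ ∑l≡0 ∑lo≡0
... | tri≈ _ 0≡l₁ _ = contradiction (sym 0≡l₁) l₁≢0
... | tri> _ _ l₁<0 = radon⁺ o₁ o₂ o₃ o₄ (neg-antimono-< l₁<0)
  (trans (solve 4 (λ a b c d → :- a :+ (:- b) :+ (:- c) :+ (:- d) := :- (a :+ b :+ c :+ d)) refl l₁ l₂ l₃ l₄)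
    (cong -_ ∑l≡0))
  (cong₂ _,_ (coordinate x₁ x₂ x₃ x₄ (cong proj₁ ∑lo≡0)) (coordinate y₁ y₂ y₃ y₄ (cong proj₂ ∑lo≡0)))
  where
  coordinate : ∀ x₁ x₂ x₃ x₄ → l₁ * x₁ + l₂ * x₂ + l₃ * x₃ + l₄ * x₄ ≡ 0ℚ →
               - l₁ * x₁ + - l₂ * x₂ + - l₃ * x₃ + - l₄ * x₄ ≡ 0ℚ
  coordinate x₁ x₂ x₃ x₄ eq = trans
    (solve 8 (λ a b c d x₁ x₂ x₃ x₄ →
      :- a :* x₁ :+ (:- b) :* x₂ :+ (:- c) :* x₃ :+ (:- d) :* x₄
      := :- (a :* x₁ :+ b :* x₂ :+ c :* x₃ :+ d :* x₄)) refl l₁ l₂ l₃ l₄ x₁ x₂ x₃ x₄)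
    (cong -_ eq)

orient : Pt → Pt → Pt → ℚ
orient (x₁ , y₁) (x₂ , y₂) (x₃ , y₃) = (x₂ - x₁) * (y₃ - y₁) - (y₂ - y₁) * (x₃ - x₁)

orientᴾ : ∀ {n} (x₁ y₁ x₂ y₂ x₃ y₃ : Polynomial n) → Polynomial n
orientᴾ x₁ y₁ x₂ y₂ x₃ y₃ = (x₂ :- x₁) :* (y₃ :- y₁) :- (y₂ :- y₁) :* (x₃ :- x₁)

-- The coefficients of the dependence are cofactors: up to sign, twice the area of the triangle left
-- when the point in question is omitted.
radon-generic : ∀ o₁ o₂ o₃ o₄ → orient o₂ o₃ o₄ ≢ 0ℚ → ∃ λ o → RadonPoint o o₁ o₂ o₃ o₄
radon-generic o₁@(x₁ , y₁) o₂@(x₂ , y₂) o₃@(x₃ , y₃) o₄@(x₄ , y₄) l₁≢0 =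
  radon≢0 {l₂ = - orient o₁ o₃ o₄} {orient o₁ o₂ o₄} { - orient o₁ o₂ o₃} o₁ o₂ o₃ o₄ l₁≢0
    (solve 8 (λ x₁ y₁ x₂ y₂ x₃ y₃ x₄ y₄ →
      orientᴾ x₂ y₂ x₃ y₃ x₄ y₄ :+ (:- orientᴾ x₁ y₁ x₃ y₃ x₄ y₄)
        :+ orientᴾ x₁ y₁ x₂ y₂ x₄ y₄ :+ (:- orientᴾ x₁ y₁ x₂ y₂ x₃ y₃) := con 0ℚ)
      refl x₁ y₁ x₂ y₂ x₃ y₃ x₄ y₄)
    (cong₂ _,_
      (solve 8 (λ x₁ y₁ x₂ y₂ x₃ y₃ x₄ y₄ →
        orientᴾ x₂ y₂ x₃ y₃ x₄ y₄ :* x₁ :+ (:- orientᴾ x₁ y₁ x₃ y₃ x₄ y₄) :* x₂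
          :+ orientᴾ x₁ y₁ x₂ y₂ x₄ y₄ :* x₃ :+ (:- orientᴾ x₁ y₁ x₂ y₂ x₃ y₃) :* x₄ := con 0ℚ)
        refl x₁ y₁ x₂ y₂ x₃ y₃ x₄ y₄)
      (solve 8 (λ x₁ y₁ x₂ y₂ x₃ y₃ x₄ y₄ →
        orientᴾ x₂ y₂ x₃ y₃ x₄ y₄ :* y₁ :+ (:- orientᴾ x₁ y₁ x₃ y₃ x₄ y₄) :* y₂
          :+ orientᴾ x₁ y₁ x₂ y₂ x₄ y₄ :* y₃ :+ (:- orientᴾ x₁ y₁ x₂ y₂ x₃ y₃) :* y₄ := con 0ℚ)
        refl x₁ y₁ x₂ y₂ x₃ y₃ x₄ y₄))

radon-collinear : ∀ o₁ o₂ o₃ o₄ → orient o₂ o₃ o₄ ≡ 0ℚ → ∃ λ o → RadonPoint o o₁ o₂ o₃ o₄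
radon-collinear o₁@(x₁ , y₁) o₂@(x₂ , y₂) o₃@(x₃ , y₃) o₄@(x₄ , y₄) o≡0 with sq o₂ o₃ ≟ 0ℚ
... | no o₂≢o₃ =
  -- The collinear points are dependent by themselves: the weights come from projecting `o₄` onto
  -- the line through `o₂` and `o₃`, and `o₁` gets weight 0. The point whose weight is known to be
  -- nonzero has to come first.
  let o , radon = radon≢0 {l₂ = f·e - sq o₂ o₃} { - f·e} {0ℚ} o₄ o₂ o₃ o₁ o₂≢o₃
        (solve 2 (λ l f → l :+ (f :- l) :+ (:- f) :+ con 0ℚ := con 0ℚ) refl (sq o₂ o₃) f·e)
        (cong₂ _,_
          (vanish (- (y₃ - y₂)) (solve 7 (λ x₁ x₂ y₂ x₃ y₃ x₄ y₄ →
            let l = sqᴾ x₂ y₂ x₃ y₃ ; f = dotᴾ (x₄ :- x₂) (y₄ :- y₂) (x₃ :- x₂) (y₃ :- y₂) in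
            l :* x₄ :+ (f :- l) :* x₂ :+ (:- f) :* x₃ :+ con 0ℚ :* x₁
            := (:- (y₃ :- y₂)) :* orientᴾ x₂ y₂ x₃ y₃ x₄ y₄) refl x₁ x₂ y₂ x₃ y₃ x₄ y₄))
          (vanish (x₃ - x₂) (solve 7 (λ y₁ x₂ y₂ x₃ y₃ x₄ y₄ →
            let l = sqᴾ x₂ y₂ x₃ y₃ ; f = dotᴾ (x₄ :- x₂) (y₄ :- y₂) (x₃ :- x₂) (y₃ :- y₂) in
            l :* y₄ :+ (f :- l) :* y₂ :+ (:- f) :* y₃ :+ con 0ℚ :* y₁
            := (x₃ :- x₂) :* orientᴾ x₂ y₂ x₃ y₃ x₄ y₄) refl y₁ x₂ y₂ x₃ y₃ x₄ y₄)))
  in o , λ p → let c₄ , c₂ , c₃ , c₁ = radon p in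
    (λ h₂ h₃ h₄ → c₁ h₄ h₂ h₃) , (λ h₁ h₃ h₄ → c₂ h₄ h₃ h₁) ,
    (λ h₁ h₂ h₄ → c₃ h₄ h₂ h₁) , (λ h₁ h₂ h₃ → c₄ h₂ h₃ h₁)
  where
  f·e = (x₄ - x₂ , y₄ - y₂) · (x₃ - x₂ , y₃ - y₂)
  vanish : ∀ {z} c → z ≡ c * orient o₂ o₃ o₄ → z ≡ 0ℚ
  vanish c eq = trans eq (trans (cong (c *_) o≡0) (*-zeroʳ c))
... | yes o₂≡o₃ = o₂ , λ p →
  (λ h₂ _ _ → h₂) , (λ _ h₃ _ → subst (λ o → sq o p ≤ _) (sym (sq≡0⇒≡ o₂ o₃ o₂≡o₃)) h₃) ,
  (λ _ h₂ _ → h₂) , (λ _ h₂ _ → h₂)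
  where
  square≡0 : ∀ {x} → x * x ≡ 0ℚ → x ≡ 0ℚ
  square≡0 {x} xx≡0 with <-cmp 0ℚ x
  ... | tri< 0<x _ _ = contradiction (sym xx≡0) (<⇒≢ (*-pos 0<x 0<x))
  ... | tri≈ _ 0≡x _ = sym 0≡x
  ... | tri> _ _ x<0 = contradiction (trans (sym xx≡0) (solve 1 (λ x → x :* x := (:- x) :* (:- x)) refl x))
                         (<⇒≢ (*-pos (neg-antimono-< x<0) (neg-antimono-< x<0)))
  sq≡0⇒≡ : ∀ p q → sq p q ≡ 0ℚ → p ≡ q
  sq≡0⇒≡ (x , y) (x′ , y′) eq = cong₂ _,_
    (unsub (square≡0 (≤-antisym (≤-trans (p≤p+q _ (0≤p*p (y - y′))) (≤-reflexive eq)) (0≤p*p (x - x′)))))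
    (unsub (square≡0 (≤-antisym (≤-trans (p≤q+p _ (0≤p*p (x - x′))) (≤-reflexive eq)) (0≤p*p (y - y′)))))
    where
    p≤p+q : ∀ p {q} → 0ℚ ≤ q → p ≤ p + q
    p≤p+q p {q} 0≤q = subst (_≤ p + q) (+-identityʳ p) (+-monoʳ-≤ p 0≤q)
    p≤q+p : ∀ p {q} → 0ℚ ≤ q → p ≤ q + p
    p≤q+p p {q} 0≤q = subst (_≤ q + p) (+-identityˡ p) (+-monoˡ-≤ p 0≤q)
    unsub : ∀ {p q} → p - q ≡ 0ℚ → p ≡ q
    unsub {p} {q} eq = trans (solve 2 (λ p q → p := (p :- q) :+ q) refl p q)
                         (trans (cong (_+ q) eq) (+-identityˡ q))

radon : ∀ o₁ o₂ o₃ o₄ → ∃ λ o → RadonPoint o o₁ o₂ o₃ o₄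
radon o₁ o₂ o₃ o₄ with orient o₂ o₃ o₄ ≟ 0ℚ
... | yes o≡0 = radon-collinear o₁ o₂ o₃ o₄ o≡0
... | no o≢0 = radon-generic o₁ o₂ o₃ o₄ o≢0

module _ {A : Set} (P : A → Pt) (t : ℚ) {Q : Pred A 0ℓ}
         (triple : ∀ {a b c} → Q a → Q b → Q c →
                   ∃ λ o → sq o (P a) ≤ t × sq o (P b) ≤ t × sq o (P c) ≤ t) where

  -- Each recursive call omits one of the first four entries, so every entry is within reach of at
  -- least three of the four centres, and a Radon point of the centres serves them all. `n` bounds
  -- the length because the shortened lists are not structurally smaller.
  helly : ∀ n xs → length xs ℕ.≤ n → All Q xs → ∃ λ o → All (λ x → sq o (P x) ≤ t) xs
  helly _ [] _ _ = (0ℚ , 0ℚ) , []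
  helly _ (a ∷ []) _ (qa ∷ []) =
    let o , ha , _ = triple qa qa qa in o , ha ∷ []
  helly _ (a ∷ b ∷ []) _ (qa ∷ qb ∷ []) =
    let o , ha , hb , _ = triple qa qb qb in o , ha ∷ hb ∷ []
  helly _ (a ∷ b ∷ c ∷ []) _ (qa ∷ qb ∷ qc ∷ []) =
    let o , ha , hb , hc = triple qa qb qc in o , ha ∷ hb ∷ hc ∷ []
  helly (suc n) (a ∷ b ∷ c ∷ d ∷ xs) (s≤s l) (qa ∷ qb ∷ qc ∷ qd ∷ qs)
    with helly n (b ∷ c ∷ d ∷ xs) l (qb ∷ qc ∷ qd ∷ qs)
       | helly n (a ∷ c ∷ d ∷ xs) l (qa ∷ qc ∷ qd ∷ qs)
       | helly n (a ∷ b ∷ d ∷ xs) l (qa ∷ qb ∷ qd ∷ qs)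
       | helly n (a ∷ b ∷ c ∷ xs) l (qa ∷ qb ∷ qc ∷ qs)
  ... | o₁ , b₁ ∷ c₁ ∷ d₁ ∷ h₁ | o₂ , a₂ ∷ c₂ ∷ d₂ ∷ h₂
      | o₃ , a₃ ∷ b₃ ∷ d₃ ∷ h₃ | o₄ , a₄ ∷ b₄ ∷ c₄ ∷ h₄ =
    combine (radon o₁ o₂ o₃ o₄)
    where
    combine : ∃ (λ o → RadonPoint o o₁ o₂ o₃ o₄) → ∃ λ o → All (λ x → sq o (P x) ≤ t) (a ∷ b ∷ c ∷ d ∷ xs)
    combine (o , r) =
      o , proj₁ (r (P a)) a₂ a₃ a₄ ∷ proj₁ (proj₂ (r (P b))) b₁ b₃ b₄
        ∷ proj₁ (proj₂ (proj₂ (r (P c)))) c₁ c₂ c₄ ∷ proj₂ (proj₂ (proj₂ (r (P d)))) d₁ d₂ d₃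
        ∷ All.zipWith (λ {x} ((g₂ , g₃) , g₄) → proj₁ (r (P x)) g₂ g₃ g₄) (All.zip (h₂ , h₃) , h₄)

-- Vertices whose neighbourhood is a union of two cliques

difference : Pt → Pt → Pt
difference (x , y) (x′ , y′) = x - x′ , y - y′

InnerSide : Pt → Pt → Pt → Set
InnerSide o v p = 0ℚ ≤ difference o v ∧ difference p v

module _ {t : ℚ} (0≤t : 0ℚ ≤ t) where
  open HalfLens 0≤t

  reflect : Pt → Pt
  reflect (x , y) = x , - y

  -- Reflection in the first axis preserves dot products and changes the sign of `∧`.
  lower : ∀ o p q → ∥ o ∥² ≤ t → o ∧ p ≤ 0ℚ → o ∧ q ≤ 0ℚ → InLens o p → InLens o q → sq p q ≤ t
  lower o p q N≤t p≤0 q≤0 p∈ q∈ = subst (_≤ t) (reflect-sq p q)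
    (upper (reflect o) (reflect p) (reflect q) (subst (_≤ t) (sym (reflect-dot o o)) N≤t)
      (reflect-wedge o p p≤0) (reflect-wedge o q q≤0) (reflect-lens p p∈) (reflect-lens q q∈))
    where
    reflect-dot : ∀ p q → reflect p · reflect q ≡ p · q
    reflect-dot (x , y) (x′ , y′) =
      solve 4 (λ x y x′ y′ → dotᴾ x (:- y) x′ (:- y′) := dotᴾ x y x′ y′) refl x y x′ y′
    reflect-sq : ∀ p q → sq (reflect p) (reflect q) ≡ sq p q
    reflect-sq (x , y) (x′ , y′) =
      solve 4 (λ x y x′ y′ → sqᴾ x (:- y) x′ (:- y′) := sqᴾ x y x′ y′) refl x y x′ y′
    reflect-wedge : ∀ p q → p ∧ q ≤ 0ℚ → 0ℚ ≤ reflect p ∧ reflect q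
    reflect-wedge (x , y) (x′ , y′) ≤0 = slack (p≤q⇒0≤q-p ≤0)
      (solve 4 (λ x y x′ y′ → con 0ℚ :- wedgeᴾ x y x′ y′ := wedgeᴾ x (:- y) x′ (:- y′) :- con 0ℚ)
        refl x y x′ y′)
    reflect-lens : ∀ p → InLens o p → InLens (reflect o) (reflect p)
    reflect-lens p (p≤t , p≤) =
      subst (_≤ t) (sym (reflect-dot p p)) p≤t ,
      subst₂ (λ pp op → pp ≤ op + op) (sym (reflect-dot p p)) (sym (reflect-dot o p)) p≤

  translate : ∀ v p q → sq (difference p v) (difference q v) ≡ sq p q
  translate (v₁ , v₂) (x , y) (x′ , y′) = solve 6 (λ v₁ v₂ x y x′ y′ →
    sqᴾ (x :- v₁) (y :- v₂) (x′ :- v₁) (y′ :- v₂) := sqᴾ x y x′ y′) refl v₁ v₂ x y x′ y′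

  in-lens : ∀ o v p → sq v p ≤ t → sq o p ≤ sq o v → InLens (difference o v) (difference p v)
  in-lens o@(o₁ , o₂) v@(v₁ , v₂) p@(p₁ , p₂) vp≤t op≤ov =
      subst (_≤ t) (sq-sym v p) vp≤t
    , slack (p≤q⇒0≤q-p op≤ov) (solve 6 (λ o₁ o₂ v₁ v₂ p₁ p₂ →
        let ov·pv = dotᴾ (o₁ :- v₁) (o₂ :- v₂) (p₁ :- v₁) (p₂ :- v₂) in
        sqᴾ o₁ o₂ v₁ v₂ :- sqᴾ o₁ o₂ p₁ p₂ := ov·pv :+ ov·pv :- sqᴾ p₁ p₂ v₁ v₂) refl o₁ o₂ v₁ v₂ p₁ p₂)

  same-side : ∀ o v p q → sq o v ≤ t → sq v p ≤ t → sq v q ≤ t → sq o p ≤ sq o v → sq o q ≤ sq o v →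
              InnerSide o v p → InnerSide o v q → sq p q ≤ t
  same-side o v p q ov≤t vp≤t vq≤t op≤ov oq≤ov p∈ q∈ = subst (_≤ t) (translate v p q)
    (upper (difference o v) (difference p v) (difference q v) ov≤t p∈ q∈
      (in-lens o v p vp≤t op≤ov) (in-lens o v q vq≤t oq≤ov))

  other-side : ∀ o v p q → sq o v ≤ t → sq v p ≤ t → sq v q ≤ t → sq o p ≤ sq o v → sq o q ≤ sq o v →
               ¬ InnerSide o v p → ¬ InnerSide o v q → sq p q ≤ t
  other-side o v p q ov≤t vp≤t vq≤t op≤ov oq≤ov p∉ q∉ = subst (_≤ t) (translate v p q)
    (lower (difference o v) (difference p v) (difference q v) ov≤t (<⇒≤ (≰⇒> p∉)) (<⇒≤ (≰⇒> q∉))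
      (in-lens o v p vp≤t op≤ov) (in-lens o v q vq≤t oq≤ov))

maximiser : ∀ {n} (f : Fin n → ℚ) {S : Pred (Fin n) 0ℓ} (S? : Decidable S) {u} → S u →
            ∃ λ v → S v × (∀ {i} → S i → f i ≤ f v)
maximiser {n} f S? {u} u∈ =
    argmax f u members
  , argmax-all f u∈ (all-filter S? (allFin n))
  , λ {i} i∈ → All.lookup (f[xs]≤f[argmax] u members) (∈-filter⁺ S? (∈-allFin i) i∈)
  where members = filter S? (allFin n)

record GoodVertex {n} (Near : Fin n → Fin n → Set) (S : Pred (Fin n) 0ℓ) : Set₁ where
  field
    vertex     : Fin n
    vertex∈    : S vertex
    Side       : Pred (Fin n) 0ℓ
    side?      : Decidable Side
    vertexSide : Side vertex
    inside     : ∀ {i j} → S i → S j → Near vertex i → Near vertex j → Side i → Side j → Near i j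
    outside    : ∀ {i j} → S i → S j → Near vertex i → Near vertex j → ¬ Side i → ¬ Side j → Near i j

module Planar {n} (P : Fin n → Pt) {t : ℚ} (0<t : 0ℚ < t) where

  Near : Fin n → Fin n → Set
  Near i j = sq (P i) (P j) ≤ t

  near? : ∀ i j → Dec (Near i j)
  near? i j = sq (P i) (P j) ≤? t

  near-refl : ∀ i → Near i i
  near-refl i = slack (<⇒≤ 0<t) (solve 3 (λ t x y → t := t :- sqᴾ x y x y) refl t (proj₁ (P i)) (proj₂ (P i)))

  near-sym : ∀ {i j} → Near i j → Near j i
  near-sym {i} {j} = subst (_≤ t) (sq-sym (P i) (P j))

  module _ (no-far-triple : ∀ {i j k} → ¬ Near i j → ¬ Near i k → Near j k)
           {S : Pred (Fin n) 0ℓ} (S? : Decidable S) where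

    3t : ℚ
    3t = t + t + t

    distant-pair : ∀ {u w} → S u → S w → 3t ≤ sq (P u) (P w) → GoodVertex Near S
    distant-pair {u} {w} u∈S w∈S 3t≤ = record
      { vertex     = u
      ; vertex∈    = u∈S
      ; Side       = λ i → ¬ Near w i
      ; side?      = λ i → ¬? (near? w i)
      ; vertexSide = λ wu≤t → <-irrefl refl (<-≤-trans t<3t (≤-trans 3t≤ (near-sym wu≤t)))
      ; inside     = λ _ _ _ _ → no-far-triple
      ; outside    = λ {i} {j} _ _ ui uj i∉ j∉ → lens (P u) (P w) (P i) (P j) 3t≤ ui uj
                       (decidable-stable (near? w i) i∉) (decidable-stable (near? w j) j∉)
      }
      where
      t<3t : t < 3t
      t<3t = subst (_< 3t) (solve 1 (λ t → t :+ con 0ℚ :+ con 0ℚ := t) refl t)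
               (+-mono-< (+-monoʳ-< t 0<t) 0<t)

    farthest-vertex : ∀ o {v} → (∀ {i} → S i → sq o (P i) ≤ t) → S v →
                      (∀ {i} → S i → sq o (P i) ≤ sq o (P v)) → GoodVertex Near S
    farthest-vertex o {v} near-o v∈ far = record
      { vertex     = v
      ; vertex∈    = v∈
      ; Side       = λ i → InnerSide o (P v) (P i)
      ; side?      = λ i → 0ℚ ≤? difference o (P v) ∧ difference (P i) (P v)
      ; vertexSide = ≤-reflexive (zero-wedge (difference o (P v)) (P v))
      ; inside     = λ {i} {j} i∈ j∈ vi vj →
          same-side (<⇒≤ 0<t) o (P v) (P i) (P j) (near-o v∈) vi vj (far i∈) (far j∈)
      ; outside    = λ {i} {j} i∈ j∈ vi vj →
          other-side (<⇒≤ 0<t) o (P v) (P i) (P j) (near-o v∈) vi vj (far i∈) (far j∈)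
      }
      where
      zero-wedge : ∀ d p → 0ℚ ≡ d ∧ difference p p
      zero-wedge (d₁ , d₂) (x , y) =
        solve 4 (λ d₁ d₂ x y → con 0ℚ := wedgeᴾ d₁ d₂ (x :- x) (y :- y)) refl d₁ d₂ x y

    module _ (close : ∀ {i j} → S i → S j → sq (P i) (P j) ≤ 3t) where

      Covered : Fin n → Fin n → Fin n → Set
      Covered i j k = ∃ λ o → sq o (P i) ≤ t × sq o (P j) ≤ t × sq o (P k) ≤ t

      near⇒covered : ∀ {i j k} → S i → S j → S k → Near i j → Covered i j k
      near⇒covered {i} {j} {k} i∈ j∈ k∈ ij with ≤-total (sq (P i) (P k)) (sq (P j) (P k))
      ... | inj₁ ik≤jk = narrow-triangle (P i) (P j) (P k) ij (close j∈ k∈) ik≤jk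
      ... | inj₂ jk≤ik =
        let o , hj , hi , hk = narrow-triangle (P j) (P i) (P k) (near-sym ij) (close i∈ k∈) jk≤ik
        in o , hi , hj , hk

      -- No three points are pairwise far, so some pair is near and can serve as the short side of
      -- `narrow-triangle`.
      covered : ∀ {i j k} → S i → S j → S k → Covered i j k
      covered {i} {j} {k} i∈ j∈ k∈ with near? i j | near? i k
      ... | yes ij | _ = near⇒covered i∈ j∈ k∈ ij
      ... | no _ | yes ik = let o , hi , hk , hj = near⇒covered i∈ k∈ j∈ ik in o , hi , hj , hk
      ... | no ¬ij | no ¬ik =
        let o , hj , hk , hi = near⇒covered j∈ k∈ i∈ (no-far-triple ¬ij ¬ik) in o , hi , hj , hk

      common-centre : ∃ λ o → ∀ {i} → S i → sq o (P i) ≤ t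
      common-centre =
        let o , all = helly P t covered (length members) members ℕ.≤-refl (all-filter S? (allFin n))
        in o , λ {i} i∈ → All.lookup all (∈-filter⁺ S? (∈-allFin i) i∈)
        where members = filter S? (allFin n)

      clustered : ∀ {u} → S u → GoodVertex Near S
      clustered u∈S =
        let o , near-o = common-centre in
        let v , v∈ , farthest = maximiser (λ i → sq o (P i)) S? u∈S in
        farthest-vertex o near-o v∈ farthest

    good-vertex : ∀ {u} → S u → GoodVertex Near S
    good-vertex u∈S with Fin.any? (λ i → Fin.any? λ j → S? i ×-dec S? j ×-dec 3t ≤? sq (P i) (P j))
    ... | yes (i , j , i∈ , j∈ , 3t≤) = distant-pair i∈ j∈ 3t≤
    ... | no ¬distant = clustered (λ {i} {j} i∈ j∈ → <⇒≤ (≰⇒> λ 3t≤ → ¬distant (i , j , i∈ , j∈ , 3t≤))) u∈S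

-- Counting

indicator : ∀ {A : Set} → Dec A → ℕ
indicator (yes _) = 1
indicator (no _) = 0

count : ∀ {n} {P : Pred (Fin n) 0ℓ} → Decidable P → ℕ
count {zero} P? = 0
count {suc n} P? = indicator (P? zero) ℕ.+ count (λ i → P? (suc i))

count-mono : ∀ {n} {P Q : Pred (Fin n) 0ℓ} (P? : Decidable P) (Q? : Decidable Q) →
             (∀ {i} → P i → Q i) → count P? ℕ.≤ count Q?
count-mono {zero} P? Q? P⊆Q = z≤n
count-mono {suc n} P? Q? P⊆Q =
  ℕ.+-mono-≤ (head (P? zero) (Q? zero)) (count-mono (λ i → P? (suc i)) (λ i → Q? (suc i)) P⊆Q)
  where
  head : ∀ p q → indicator p ℕ.≤ indicator q
  head (no _) _ = z≤n
  head (yes _) (yes _) = ℕ.≤-refl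
  head (yes p) (no ¬q) = contradiction (P⊆Q p) ¬q

count-cong : ∀ {n} {P Q : Pred (Fin n) 0ℓ} (P? : Decidable P) (Q? : Decidable Q) →
             (∀ {i} → P i → Q i) → (∀ {i} → Q i → P i) → count P? ≡ count Q?
count-cong P? Q? P⊆Q Q⊆P = ℕ.≤-antisym (count-mono P? Q? P⊆Q) (count-mono Q? P? Q⊆P)

count-split : ∀ {n} {P Q R : Pred (Fin n) 0ℓ} (P? : Decidable P) (Q? : Decidable Q) (R? : Decidable R) →
              (∀ {i} → P i → Q i ⊎ R i) → (∀ {i} → Q i → P i) → (∀ {i} → R i → P i) →
              (∀ {i} → Q i → ¬ R i) → count P? ≡ count Q? ℕ.+ count R?
count-split {zero} P? Q? R? P⊆ Q⊆P R⊆P disjoint = refl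
count-split {suc n} P? Q? R? P⊆ Q⊆P R⊆P disjoint = trans
  (cong₂ ℕ._+_ (head (P? zero) (Q? zero) (R? zero))
    (count-split (λ i → P? (suc i)) (λ i → Q? (suc i)) (λ i → R? (suc i)) P⊆ Q⊆P R⊆P disjoint))
  (interchange (indicator (Q? zero)) _ _ _)
  where
  interchange : ∀ a b c d → (a ℕ.+ b) ℕ.+ (c ℕ.+ d) ≡ (a ℕ.+ c) ℕ.+ (b ℕ.+ d)
  interchange = solve-∀
  head : ∀ p q r → indicator p ≡ indicator q ℕ.+ indicator r
  head (yes p) (yes q) (yes r) = contradiction r (disjoint q)
  head (yes p) (yes q) (no _) = refl
  head (yes p) (no _) (yes r) = refl
  head (yes p) (no ¬q) (no ¬r) = contradiction (P⊆ p) [ ¬q , ¬r ]′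
  head (no ¬p) (yes q) _ = contradiction (Q⊆P q) ¬p
  head (no ¬p) (no _) (yes r) = contradiction (R⊆P r) ¬p
  head (no _) (no _) (no _) = refl

count-empty : ∀ {n} {P : Pred (Fin n) 0ℓ} (P? : Decidable P) → (∀ i → ¬ P i) → count P? ≡ 0
count-empty {zero} P? ¬P = refl
count-empty {suc n} P? ¬P with P? zero
... | yes p = contradiction p (¬P zero)
... | no _ = count-empty (λ i → P? (suc i)) (λ i → ¬P (suc i))

count-singleton : ∀ {n} (x : Fin n) → count (Fin._≟ x) ≡ 1
count-singleton {suc n} zero = cong suc (count-empty {n} (λ i → suc i Fin.≟ zero) λ _ ())
count-singleton {suc n} (suc x) = trans
  (count-cong {n} (λ i → suc i Fin.≟ suc x) (Fin._≟ x) Fin.suc-injective (cong suc)) (count-singleton x)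

infixl 6 _∖_ _∖?_
_∖_ : ∀ {n} → Pred (Fin n) 0ℓ → Fin n → Pred (Fin n) 0ℓ
(P ∖ x) i = P i × i ≢ x

_∖?_ : ∀ {n} {P : Pred (Fin n) 0ℓ} → Decidable P → ∀ x → Decidable (P ∖ x)
(P? ∖? x) i = P? i ×-dec ¬? (i Fin.≟ x)

count-remove : ∀ {n} {P : Pred (Fin n) 0ℓ} (P? : Decidable P) {x} → P x →
               count P? ≡ suc (count (P? ∖? x))
count-remove P? {x} px = trans
  (count-split P? (Fin._≟ x) (P? ∖? x) (λ {i} → split i) (λ { refl → px }) proj₁ (λ i≡x (_ , i≢x) → i≢x i≡x))
  (cong (ℕ._+ count (P? ∖? x)) (count-singleton x))
  where
  split : ∀ i → _ → i ≡ x ⊎ _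
  split i pi with i Fin.≟ x
  ... | yes i≡x = inj₁ i≡x
  ... | no i≢x = inj₂ (pi , i≢x)

count-remove₂ : ∀ {n} {P : Pred (Fin n) 0ℓ} (P? : Decidable P) {x y} → P x → P y → x ≢ y →
                count P? ≡ 2 ℕ.+ count (P? ∖? x ∖? y)
count-remove₂ P? px py x≢y = trans (count-remove P? px) (cong suc (count-remove (P? ∖? _) (py , x≢y ∘ sym)))

count-mono-< : ∀ {n} {P Q : Pred (Fin n) 0ℓ} (P? : Decidable P) (Q? : Decidable Q) {x} →
               (∀ {i} → P i → Q i) → Q x → ¬ P x → count P? ℕ.< count Q?
count-mono-< P? Q? {x} P⊆Q qx ¬px = subst (count P? ℕ.<_) (sym (count-remove Q? qx))
  (s≤s (count-mono P? (Q? ∖? x) λ pi → P⊆Q pi , λ { refl → ¬px pi }))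

count-<⇒∃ : ∀ {n} {P Q : Pred (Fin n) 0ℓ} (P? : Decidable P) (Q? : Decidable Q) →
            count P? ℕ.< count Q? → ∃ λ x → Q x × ¬ P x
count-<⇒∃ P? Q? P<Q with Fin.any? (λ x → Q? x ×-dec ¬? (P? x))
... | yes found = found
... | no none = contradiction P<Q (ℕ.≤⇒≯ (count-mono Q? P? λ {i} qi →
        decidable-stable (P? i) λ ¬pi → none (i , qi , ¬pi)))

-- Matchings in the complement

module Matchings {n} (Near : Fin n → Fin n → Set) where

  -- The 2-cycles of the involution are the edges and its fixed points are unmatched. `valid` at
  -- `mate i` puts the other end of an edge into `S`.
  record Matching (S : Pred (Fin n) 0ℓ) : Set where
    field
      mate       : Fin n → Fin n
      involutive : ∀ i → mate (mate i) ≡ i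
      valid      : ∀ {i} → mate i ≢ i → S i × ¬ Near i (mate i)

    mate-swap : ∀ {i j} → mate i ≡ j → mate j ≡ i
    mate-swap {i} refl = involutive i

  open Matching public

  Missed : ∀ (S : Pred (Fin n) 0ℓ) → (Fin n → Fin n) → Pred (Fin n) 0ℓ
  Missed S f i = S i × f i ≡ i

  missed? : ∀ {S} → Decidable S → ∀ f → Decidable (Missed S f)
  missed? S? f i = S? i ×-dec (f i Fin.≟ i)

  missed : ∀ {S} → Decidable S → (Fin n → Fin n) → ℕ
  missed S? f = count (missed? S? f)

  ColouringOf : Pred (Fin n) 0ℓ → ℕ → (Fin n → ℕ) → Set
  ColouringOf S k c = (∀ {i} → S i → c i ℕ.< k) × (∀ {i j} → S i → S j → i ≢ j → Near i j → c i ≢ c j)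

  module _ (f : Fin n → Fin n) (f-involutive : ∀ i → f (f i) ≡ i) (near-sym : ∀ {i j} → Near i j → Near j i) where

    -- Each orbit of `f` is a colour class and contributes 2 to the right side: a pair counts as two
    -- vertices, a fixed point once as a vertex and once as missed. The recursion removes one orbit
    -- at a time, and `b` bounds the size.
    pairs⇒colouring : ∀ b {S} (S? : Decidable S) → count S? ℕ.< b → (∀ {i} → S i → S (f i)) →
                      (∀ {i} → S i → f i ≢ i → ¬ Near i (f i)) →
                      ∃ λ k → ∃ λ c → ColouringOf S k c × k ℕ.+ k ≡ count S? ℕ.+ missed S? f
    pairs⇒colouring (suc b) {S} S? (s≤s S≤b) closed far with Fin.any? S?
    ... | no ¬S = 0 , (λ _ → 0) , ((λ {i} i∈ → ⊥-elim (¬S (i , i∈))) , λ {i} i∈ → ⊥-elim (¬S (i , i∈)))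
                , sym (cong₂ ℕ._+_ (count-empty S? λ i i∈ → ¬S (i , i∈))
                                 (count-empty (missed? S? f) λ i (i∈ , _) → ¬S (i , i∈)))
    ... | yes (x , x∈) = suc k , c , (c<suc-k , proper) , trans (cong suc (ℕ.+-suc k k)) (trans (cong (2 ℕ.+_) size′) (sym size))
      where
      Class : Pred (Fin n) 0ℓ
      Class i = i ≡ x ⊎ i ≡ f x
      class? : Decidable Class
      class? i = (i Fin.≟ x) ⊎-dec (i Fin.≟ f x)
      S′ : Pred (Fin n) 0ℓ
      S′ i = S i × ¬ Class i
      S′? : Decidable S′
      S′? i = S? i ×-dec ¬? (class? i)
      S′<S : count S′? ℕ.< count S?
      S′<S = count-mono-< S′? S? proj₁ x∈ λ (_ , ¬x) → ¬x (inj₁ refl)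
      class-closed : ∀ {i} → Class (f i) → Class i
      class-closed {i} (inj₁ refl) = inj₂ (sym (f-involutive i))
      class-closed {i} (inj₂ fi≡fx) = inj₁ (trans (sym (f-involutive i)) (trans (cong f fi≡fx) (f-involutive x)))
      rest = pairs⇒colouring b S′? (ℕ.<-≤-trans S′<S S≤b)
               (λ (i∈ , ¬i) → closed i∈ , ¬i ∘ class-closed) (λ (i∈ , _) → far i∈)
      k = proj₁ rest
      c′ = proj₁ (proj₂ rest)
      c′<k = proj₁ (proj₁ (proj₂ (proj₂ rest)))
      proper′ = proj₂ (proj₁ (proj₂ (proj₂ rest)))
      size′ : k ℕ.+ k ≡ count S′? ℕ.+ missed S′? f
      size′ = proj₂ (proj₂ (proj₂ rest))
      c : Fin n → ℕ
      c i with class? i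
      ... | yes _ = k
      ... | no _ = c′ i
      c<suc-k : ∀ {i} → S i → c i ℕ.< suc k
      c<suc-k {i} i∈ with class? i
      ... | yes _ = ℕ.≤-refl
      ... | no ¬i = ℕ.m<n⇒m<1+n (c′<k (i∈ , ¬i))
      class-far : ∀ {i j} → i ≢ j → Class i → Class j → ¬ Near i j
      class-far i≢j (inj₁ refl) (inj₁ refl) = contradiction refl i≢j
      class-far i≢j (inj₁ refl) (inj₂ refl) = far x∈ (i≢j ∘ sym)
      class-far i≢j (inj₂ refl) (inj₁ refl) = far x∈ i≢j ∘ near-sym
      class-far i≢j (inj₂ refl) (inj₂ refl) = contradiction refl i≢j
      proper : ∀ {i j} → S i → S j → i ≢ j → Near i j → c i ≢ c j
      proper {i} {j} i∈ j∈ i≢j ij with class? i | class? j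
      ... | yes ci | yes cj = contradiction ij (class-far i≢j ci cj)
      ... | yes _ | no ¬j = λ k≡ → ℕ.<-irrefl (sym k≡) (c′<k (j∈ , ¬j))
      ... | no ¬i | yes _ = λ k≡ → ℕ.<-irrefl k≡ (c′<k (i∈ , ¬i))
      ... | no ¬i | no ¬j = proper′ (i∈ , ¬i) (j∈ , ¬j) i≢j ij
      size : count S? ℕ.+ missed S? f ≡ 2 ℕ.+ (count S′? ℕ.+ missed S′? f)
      size with f x Fin.≟ x
      ... | yes fx≡x = trans
              (cong₂ ℕ._+_
                (trans (count-remove S? x∈) (cong suc (count-cong (S? ∖? x) S′?
                  (λ (i∈ , i≢x) → i∈ , [ i≢x , (λ i≡fx → i≢x (trans i≡fx fx≡x)) ]′)
                  (λ (i∈ , ¬i) → i∈ , ¬i ∘ inj₁))))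
                (trans (count-remove (missed? S? f) (x∈ , fx≡x)) (cong suc (count-cong (missed? S? f ∖? x) (missed? S′? f)
                  (λ ((i∈ , fi) , i≢x) → (i∈ , [ i≢x , (λ i≡fx → i≢x (trans i≡fx fx≡x)) ]′) , fi)
                  (λ ((i∈ , ¬i) , fi) → (i∈ , fi) , ¬i ∘ inj₁)))))
              (cong suc (ℕ.+-suc _ _))
      ... | no fx≢x = cong₂ ℕ._+_
              (trans (count-remove₂ S? x∈ (closed x∈) (fx≢x ∘ sym)) (cong (2 ℕ.+_) (count-cong (S? ∖? x ∖? f x) S′?
                (λ ((i∈ , i≢x) , i≢fx) → i∈ , [ i≢x , i≢fx ]′)
                (λ (i∈ , ¬i) → (i∈ , ¬i ∘ inj₁) , ¬i ∘ inj₂))))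
              (count-cong (missed? S? f) (missed? S′? f)
                (λ (i∈ , fi≡i) → (i∈ , λ { (inj₁ refl) → fx≢x fi≡i
                                         ; (inj₂ refl) → fx≢x (trans (sym fi≡i) (f-involutive x)) }) , fi≡i)
                (λ ((i∈ , _) , fi) → i∈ , fi))

-- Exchanges in matchings and Gallai's lemma

module Rewiring {n} (Near : Fin n → Fin n → Set) (near-sym : ∀ {i j} → Near i j → Near j i)
                {S : Pred (Fin n) 0ℓ} (S? : Decidable S) where
  open Matchings Near

  module _ (m : Matching S) {x y : Fin n} (x-missed : Missed S (mate m) x) (y-missed : Missed S (mate m) y)
           (¬xy : ¬ Near x y) (x≢y : x ≢ y) where

    private
      f : Fin n → Fin n
      f i with i Fin.≟ x | i Fin.≟ y
      ... | yes _ | _ = y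
      ... | no _ | yes _ = x
      ... | no _ | no _ = mate m i

      f-x : f x ≡ y
      f-x with x Fin.≟ x
      ... | yes _ = refl
      ... | no x≢x = contradiction refl x≢x

      f-y : f y ≡ x
      f-y with y Fin.≟ x | y Fin.≟ y
      ... | yes y≡x | _ = y≡x
      ... | no _ | yes _ = refl
      ... | no _ | no y≢y = contradiction refl y≢y

      f-other : ∀ {i} → i ≢ x → i ≢ y → f i ≡ mate m i
      f-other {i} i≢x i≢y with i Fin.≟ x | i Fin.≟ y
      ... | yes i≡x | _ = contradiction i≡x i≢x
      ... | no _ | yes i≡y = contradiction i≡y i≢y
      ... | no _ | no _ = refl

      mate-avoids : ∀ {i z} → mate m z ≡ z → i ≢ z → mate m i ≢ z
      mate-avoids z-fixed i≢z mi≡z = i≢z (trans (sym (mate-swap m mi≡z)) z-fixed)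

    link : Matching S
    link .mate = f
    link .involutive i = involutive′ (i Fin.≟ x) (i Fin.≟ y)
      where
      involutive′ : Dec (i ≡ x) → Dec (i ≡ y) → f (f i) ≡ i
      involutive′ (yes refl) _ = trans (cong f f-x) f-y
      involutive′ (no _) (yes refl) = trans (cong f f-y) f-x
      involutive′ (no i≢x) (no i≢y) = trans (cong f (f-other i≢x i≢y))
        (trans (f-other (mate-avoids (proj₂ x-missed) i≢x) (mate-avoids (proj₂ y-missed) i≢y)) (involutive m i))
    link .valid {i} = valid′ (i Fin.≟ x) (i Fin.≟ y)
      where
      valid′ : Dec (i ≡ x) → Dec (i ≡ y) → f i ≢ i → S i × ¬ Near i (f i)
      valid′ (yes refl) _ _ = proj₁ x-missed , subst (λ j → ¬ Near x j) (sym f-x) ¬xy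
      valid′ (no _) (yes refl) _ = proj₁ y-missed , subst (λ j → ¬ Near y j) (sym f-y) (¬xy ∘ near-sym)
      valid′ (no i≢x) (no i≢y) moved =
        subst (λ j → S i × ¬ Near i j) (sym eq) (valid m (moved ∘ trans eq))
        where eq = f-other i≢x i≢y

    link-x : mate link x ≡ y
    link-x = f-x

    link-y : mate link y ≡ x
    link-y = f-y

    link-other : ∀ {i} → i ≢ x → i ≢ y → mate link i ≡ mate m i
    link-other = f-other

    link-missed : missed S? (mate m) ≡ 2 ℕ.+ missed S? (mate link)
    link-missed = trans (count-remove₂ (missed? S? (mate m)) x-missed y-missed x≢y)
      (cong (2 ℕ.+_) (count-cong (missed? S? (mate m) ∖? x ∖? y) (missed? S? f)
        (λ (((i∈ , mi) , i≢x) , i≢y) → i∈ , trans (f-other i≢x i≢y) mi)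
        (λ {i} (i∈ , fi) → unlinked i (i Fin.≟ x) (i Fin.≟ y) i∈ fi)))
      where
      unlinked : ∀ i → Dec (i ≡ x) → Dec (i ≡ y) → S i → f i ≡ i → (Missed S (mate m) ∖ x ∖ y) i
      unlinked i (yes refl) _ _ fx≡x = contradiction (trans (sym fx≡x) f-x) x≢y
      unlinked i (no _) (yes refl) _ fy≡y = contradiction (trans (sym f-y) fy≡y) x≢y
      unlinked i (no i≢x) (no i≢y) i∈ fi = ((i∈ , trans (sym (f-other i≢x i≢y)) fi) , i≢x) , i≢y

  module _ (m : Matching S) {y : Fin n} (y-moved : mate m y ≢ y) where

    private
      z = mate m y

      f : Fin n → Fin n
      f i with i Fin.≟ y | i Fin.≟ z
      ... | yes _ | _ = i
      ... | no _ | yes _ = i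
      ... | no _ | no _ = mate m i

      f-y : f y ≡ y
      f-y with y Fin.≟ y
      ... | yes _ = refl
      ... | no y≢y = contradiction refl y≢y

      f-z : f z ≡ z
      f-z with z Fin.≟ y | z Fin.≟ z
      ... | yes _ | _ = refl
      ... | no _ | yes _ = refl
      ... | no _ | no z≢z = contradiction refl z≢z

      f-other : ∀ {i} → i ≢ y → i ≢ z → f i ≡ mate m i
      f-other {i} i≢y i≢z with i Fin.≟ y | i Fin.≟ z
      ... | yes i≡y | _ = contradiction i≡y i≢y
      ... | no _ | yes i≡z = contradiction i≡z i≢z
      ... | no _ | no _ = refl

    unlink : Matching S
    unlink .mate = f
    unlink .involutive i = involutive′ (i Fin.≟ y) (i Fin.≟ z)
      where
      involutive′ : Dec (i ≡ y) → Dec (i ≡ z) → f (f i) ≡ i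
      involutive′ (yes refl) _ = trans (cong f f-y) f-y
      involutive′ (no _) (yes refl) = trans (cong f f-z) f-z
      involutive′ (no i≢y) (no i≢z) = trans (cong f (f-other i≢y i≢z))
        (trans (f-other (λ mi≡y → i≢z (sym (mate-swap m mi≡y)))
                        (λ mi≡z → i≢y (trans (sym (involutive m i)) (trans (cong (mate m) mi≡z) (involutive m y)))))
               (involutive m i))
    unlink .valid {i} = valid′ (i Fin.≟ y) (i Fin.≟ z)
      where
      valid′ : Dec (i ≡ y) → Dec (i ≡ z) → f i ≢ i → S i × ¬ Near i (f i)
      valid′ (yes refl) _ moved = contradiction f-y moved
      valid′ (no _) (yes refl) moved = contradiction f-z moved
      valid′ (no i≢y) (no i≢z) moved =
        subst (λ j → S i × ¬ Near i j) (sym eq) (valid m (moved ∘ trans eq))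
        where eq = f-other i≢y i≢z

    unlink-y : mate unlink y ≡ y
    unlink-y = f-y

    unlink-other : ∀ {i} → i ≢ y → i ≢ mate m y → mate unlink i ≡ mate m i
    unlink-other = f-other

    unlink-missed : missed S? (mate unlink) ≡ 2 ℕ.+ missed S? (mate m)
    unlink-missed = trans
      (count-remove₂ (missed? S? f) (proj₁ (valid m y-moved) , f-y) (proj₁ (valid m z-moved) , f-z) (y-moved ∘ sym))
      (cong (2 ℕ.+_) (count-cong (missed? S? f ∖? y ∖? z) (missed? S? (mate m))
        (λ (((i∈ , fi) , i≢y) , i≢z) → i∈ , trans (sym (f-other i≢y i≢z)) fi)
        (λ (i∈ , mi) → ((i∈ , trans (f-other (i≢y mi) (i≢z mi)) mi) , i≢y mi) , i≢z mi)))
      where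
      z-moved : mate m z ≢ z
      z-moved mz≡z = y-moved (trans (sym mz≡z) (involutive m y))
      i≢y : ∀ {i} → mate m i ≡ i → i ≢ y
      i≢y mi refl = y-moved mi
      i≢z : ∀ {i} → mate m i ≡ i → i ≢ z
      i≢z mi refl = z-moved mi

  module Maximum {μ : ℕ} (minimal : ∀ (m : Matching S) → μ ℕ.≤ missed S? (mate m)) where

    Maximal : Matching S → Set
    Maximal m = missed S? (mate m) ≡ μ

    -- Linking two missed vertices that are far apart would leave two missed vertices fewer.
    missed-near : ∀ m → Maximal m → ∀ {x y} → Missed S (mate m) x → Missed S (mate m) y → x ≢ y → ¬ ¬ Near x y
    missed-near m m-max x-missed y-missed x≢y ¬xy = ℕ.<⇒≱
      (subst (missed S? (mate (link m x-missed y-missed ¬xy x≢y)) ℕ.<_)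
        (trans (sym (link-missed m x-missed y-missed ¬xy x≢y)) m-max) (ℕ.m<n⇒m<1+n ℕ.≤-refl))
      (minimal (link m x-missed y-missed ¬xy x≢y))

    -- The relation behind Gallai's lemma: it contains the edges of H by `missed-near` and is
    -- transitive through avoidable vertices by `exclusive-trans`.
    Exclusive : Fin n → Fin n → Set
    Exclusive u v = ∀ m → Maximal m → mate m u ≡ u → mate m v ≡ v → ⊥

    module _ {u v t : Fin n} (u∈ : S u) (v∈ : S v) (t∈ : S t) (u≢v : u ≢ v) (ut : Exclusive u t) (tv : Exclusive t v)
             (m : Matching S) (m-max : Maximal m) (mu : mate m u ≡ u) (mv : mate m v ≡ v) where

      Differ : Matching S → Pred (Fin n) 0ℓ
      Differ m′ i = mate m i ≢ mate m′ i

      differ? : ∀ m′ → Decidable (Differ m′)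
      differ? m′ i = ¬? (mate m i Fin.≟ mate m′ i)

      -- A vertex x ≠ t missed by m′ but not by m is re-matched in m′ as in m, which brings m′ closer to m.
      no-match-missing : ∀ b m′ → count (differ? m′) ℕ.< b → Maximal m′ → ¬ mate m′ t ≡ t
      no-match-missing (suc b) m′ (s≤s ≤b) m′-max m′t = no-match-missing b m″ (ℕ.<-≤-trans closer ≤b) m″-max m″t
        where
        -- Both matchings miss μ vertices; setting aside two for `m` but only one for `m′` leaves a
        -- vertex `x` over.
        gap : count (missed? S? (mate m) ∖? u ∖? v) ℕ.< count (missed? S? (mate m′) ∖? t)
        gap = ℕ.≤-reflexive (ℕ.suc-injective (trans
          (trans (sym (count-remove₂ (missed? S? (mate m)) (u∈ , mu) (v∈ , mv) u≢v)) m-max)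
          (trans (sym m′-max) (count-remove (missed? S? (mate m′)) (t∈ , m′t)))))
        found = count-<⇒∃ (missed? S? (mate m) ∖? u ∖? v) (missed? S? (mate m′) ∖? t) gap
        x = proj₁ found
        x∈ = proj₁ (proj₁ (proj₁ (proj₂ found)))
        m′x : mate m′ x ≡ x
        m′x = proj₂ (proj₁ (proj₁ (proj₂ found)))
        x≢t : x ≢ t
        x≢t = proj₂ (proj₁ (proj₂ found))
        x≢u : x ≢ u
        x≢u x≡u = ut m′ m′-max (subst (λ i → mate m′ i ≡ i) x≡u m′x) m′t
        x≢v : x ≢ v
        x≢v x≡v = tv m′ m′-max m′t (subst (λ i → mate m′ i ≡ i) x≡v m′x)
        y = mate m x
        y≢x : y ≢ x
        y≢x mx = proj₂ (proj₂ found) (((x∈ , mx) , x≢u) , x≢v)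
        ¬xy : ¬ Near x y
        ¬xy = proj₂ (valid m y≢x)
        y∈ : S y
        y∈ = proj₁ (valid m λ my≡y → y≢x (trans (sym my≡y) (involutive m x)))
        -- Were `y` missed by `m′` as well, it could be linked to `x`.
        y-moved : mate m′ y ≢ y
        y-moved m′y = missed-near m′ m′-max (x∈ , m′x) (y∈ , m′y) (y≢x ∘ sym) ¬xy
        z = mate m′ y
        x≢z : x ≢ z
        x≢z x≡z = y≢x (trans (sym (mate-swap m′ (sym x≡z))) m′x)
        t≢y : t ≢ y
        t≢y t≡y = y-moved (subst (λ i → mate m′ i ≡ i) t≡y m′t)
        t≢z : t ≢ z
        t≢z t≡z = t≢y (trans (sym m′t) (mate-swap m′ (sym t≡z)))
        m° = unlink m′ y-moved
        x-missed : Missed S (mate m°) x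
        x-missed = x∈ , trans (unlink-other m′ y-moved (y≢x ∘ sym) x≢z) m′x
        y-missed : Missed S (mate m°) y
        y-missed = y∈ , unlink-y m′ y-moved
        m″ = link m° x-missed y-missed ¬xy (y≢x ∘ sym)
        m″-other : ∀ {i} → i ≢ x → i ≢ y → i ≢ z → mate m″ i ≡ mate m′ i
        m″-other i≢x i≢y i≢z = trans (link-other m° x-missed y-missed ¬xy (y≢x ∘ sym) i≢x i≢y)
                                     (unlink-other m′ y-moved i≢y i≢z)
        m″-max : Maximal m″
        m″-max = trans (ℕ.suc-injective (ℕ.suc-injective (trans
          (sym (link-missed m° x-missed y-missed ¬xy (y≢x ∘ sym))) (unlink-missed m′ y-moved)))) m′-max
        m″t : mate m″ t ≡ t
        m″t = trans (m″-other (x≢t ∘ sym) t≢y t≢z) m′t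
        m″x : mate m x ≡ mate m″ x
        m″x = sym (link-x m° x-missed y-missed ¬xy (y≢x ∘ sym))
        m″y : mate m y ≡ mate m″ y
        m″y = trans (involutive m x) (sym (link-y m° x-missed y-missed ¬xy (y≢x ∘ sym)))
        still : ∀ i → Dec (i ≡ x) → Dec (i ≡ y) → Dec (i ≡ z) → Differ m″ i → Differ m′ i
        still i (yes refl) _ _ d = contradiction m″x d
        still i (no _) (yes refl) _ d = contradiction m″y d
        -- The exchange also changes the mate of `z`, but `m` and `m′` disagreed there already,
        -- because `m` matches `y` to `x`.
        still i (no _) (no _) (yes refl) _ = λ mz≡ → x≢z (trans (sym (involutive m x))
          (mate-swap m (trans mz≡ (involutive m′ y))))
        still i (no i≢x) (no i≢y) (no i≢z) d = λ mi≡ → d (trans mi≡ (sym (m″-other i≢x i≢y i≢z)))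
        closer : count (differ? m″) ℕ.< count (differ? m′)
        closer = count-mono-< (differ? m″) (differ? m′) (λ {i} → still i (i Fin.≟ x) (i Fin.≟ y) (i Fin.≟ z))
          (λ mx≡ → y≢x (trans mx≡ m′x)) (λ d → d m″x)

    -- Some maximum matching has to miss `t`, since otherwise both relations with `t` hold
    -- vacuously.
    exclusive-trans : ∀ {u v t} → S u → S v → S t → u ≢ v → (∃ λ m → Maximal m × mate m t ≡ t) →
                      Exclusive u t → Exclusive t v → Exclusive u v
    exclusive-trans u∈ v∈ t∈ u≢v (m′ , m′-max , m′t) ut tv m m-max mu mv =
      no-match-missing u∈ v∈ t∈ u≢v ut tv m m-max mu mv _ m′ ℕ.≤-refl m′-max m′t

¬¬-all : ∀ {n} {ℓ : Level} {P : Fin n → Set ℓ} → (∀ i → ¬ ¬ P i) → ¬ ¬ (∀ i → P i)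
¬¬-all {zero} _ ¬∀ = ¬∀ λ ()
¬¬-all {suc n} ¬¬P ¬∀ = ¬¬P zero λ p → ¬¬-all (λ i → ¬¬P (suc i)) λ ps →
  ¬∀ λ { zero → p ; (suc i) → ps i }

-- Induction over induced subgraphs

module Cover {n} (Near : Fin n → Fin n → Set) (near? : ∀ i j → Dec (Near i j))
             (near-refl : ∀ i → Near i i) (near-sym : ∀ {i j} → Near i j → Near j i)
             (no-far-triple : ∀ {i j k} → ¬ Near i j → ¬ Near i k → Near j k)
             (good-vertex : ∀ {S : Pred (Fin n) 0ℓ} → Decidable S → ∀ {u} → S u → GoodVertex Near S) where

  open Matchings Near

  record CliqueIn (S : Pred (Fin n) 0ℓ) : Set₁ where
    field
      Members  : Pred (Fin n) 0ℓ
      members? : Decidable Members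
      members⊆ : ∀ {i} → Members i → S i
      adjacent : ∀ {i j} → Members i → Members j → Near i j

    size : ℕ
    size = count members?

  open CliqueIn using (members?; members⊆; adjacent; size)

  larger : ∀ {S} (Q R : CliqueIn S) → ∃ λ T → size Q ℕ.≤ size T × size R ℕ.≤ size T
  larger Q R with ℕ.≤-total (size Q) (size R)
  ... | inj₁ Q≤R = R , Q≤R , ℕ.≤-refl
  ... | inj₂ R≤Q = Q , ℕ.≤-refl , R≤Q

  -- v belongs to two of the three cliques, whence the gain of one.
  third-clique : ∀ {S : Pred (Fin n) 0ℓ} (S? : Decidable S) {u} → S u →
                 ∃ λ (Q : CliqueIn S) → suc (count S?) ℕ.≤ 3 ℕ.* size Q
  third-clique {S} S? u∈ = T , ℕ.≤-trans (ℕ.≤-reflexive total) (ℕ.≤-trans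
      (ℕ.+-mono-≤ (ℕ.+-mono-≤ (ℕ.≤-trans A≤AB AB≤T) (ℕ.≤-trans B≤AB AB≤T)) C≤T)
      (ℕ.≤-reflexive (triple (size T))))
    where
    open GoodVertex (good-vertex S? u∈) renaming (vertex to v)
    InA InB InB⁻ InC InN : Pred (Fin n) 0ℓ
    InN i = S i × Near v i
    InA i = (S i × Near v i) × Side i
    InB⁻ i = (S i × Near v i) × ¬ Side i
    InB i = i ≡ v ⊎ InB⁻ i
    InC i = S i × ¬ Near v i
    inN? : Decidable InN
    inN? i = S? i ×-dec near? v i
    inA? : Decidable InA
    inA? i = (S? i ×-dec near? v i) ×-dec side? i
    inB⁻? : Decidable InB⁻
    inB⁻? i = (S? i ×-dec near? v i) ×-dec ¬? (side? i)
    inB? : Decidable InB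
    inB? i = (i Fin.≟ v) ⊎-dec inB⁻? i
    inC? : Decidable InC
    inC? i = S? i ×-dec ¬? (near? v i)
    A B C : CliqueIn S
    A = record { members? = inA? ; members⊆ = proj₁ ∘ proj₁
               ; adjacent = λ ((i∈ , vi) , i-side) ((j∈ , vj) , j-side) → inside i∈ j∈ vi vj i-side j-side }
    B = record { members? = inB?
               ; members⊆ = λ { (inj₁ refl) → vertex∈ ; (inj₂ i∈) → proj₁ (proj₁ i∈) }
               ; adjacent = λ { (inj₁ refl) (inj₁ refl) → near-refl v
                              ; (inj₁ refl) (inj₂ ((_ , vj) , _)) → vj
                              ; (inj₂ ((_ , vi) , _)) (inj₁ refl) → near-sym vi
                              ; (inj₂ ((i∈ , vi) , ¬i)) (inj₂ ((j∈ , vj) , ¬j)) → outside i∈ j∈ vi vj ¬i ¬j } }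
    C = record { members? = inC? ; members⊆ = proj₁ ; adjacent = λ (_ , ¬vi) (_ , ¬vj) → no-far-triple ¬vi ¬vj }
    AB = larger A B
    A≤AB = proj₁ (proj₂ AB)
    B≤AB = proj₂ (proj₂ AB)
    ABC = larger (proj₁ AB) C
    T = proj₁ ABC
    AB≤T = proj₁ (proj₂ ABC)
    C≤T = proj₂ (proj₂ ABC)
    split : ∀ {P R : Pred (Fin n) 0ℓ} → Decidable R → ∀ {i} → P i → (P i × R i) ⊎ (P i × ¬ R i)
    split R? {i} pi with R? i
    ... | yes ri = inj₁ (pi , ri)
    ... | no ¬ri = inj₂ (pi , ¬ri)
    triple : ∀ a → a ℕ.+ a ℕ.+ a ≡ 3 ℕ.* a
    triple = solve-∀
    total : suc (count S?) ≡ size A ℕ.+ size B ℕ.+ size C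
    total = trans (cong suc (trans
        (count-split S? inN? inC? (split {S} (near? v)) proj₁ proj₁ (λ (_ , vi) (_ , ¬vi) → ¬vi vi))
        (cong (ℕ._+ count inC?) (count-split inN? inA? inB⁻? (split {InN} side?) proj₁ proj₁ (λ (_ , si) (_ , ¬si) → ¬si si)))))
      (trans (shift (count inA?) (count inB⁻?) (count inC?))
        (cong (λ b → size A ℕ.+ b ℕ.+ size C) (sym (trans
          (count-split inB? (Fin._≟ v) inB⁻? id inj₁ inj₂ (λ { refl (_ , ¬side) → ¬side vertexSide }))
          (cong (ℕ._+ count inB⁻?) (count-singleton v))))))
      where
      shift : ∀ a b c → suc (a ℕ.+ b ℕ.+ c) ≡ a ℕ.+ suc b ℕ.+ c
      shift = solve-∀

  -- The invariant of the induction; by `matching⇒colouring`, the left side of the bound is twice a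
  -- number of colours.
  Balanced : ∀ {S : Pred (Fin n) 0ℓ} → Decidable S → Set₁
  Balanced {S} S? = Σ (Matching S) λ m → Σ (CliqueIn S) λ Q → count S? ℕ.+ missed S? (mate m) ℕ.≤ 3 ℕ.* size Q

  unmatched : ∀ {S} → Matching S
  unmatched = record { mate = id ; involutive = λ _ → refl ; valid = λ i≢i → contradiction refl i≢i }

  empty-clique : ∀ {S} → CliqueIn S
  empty-clique = record { members? = λ _ → no id ; members⊆ = ⊥-elim ; adjacent = ⊥-elim }

  matching-closed : ∀ {S} (m : Matching S) {i} → S i → S (mate m i)
  matching-closed {S} m {i} i∈ with mate m i Fin.≟ i
  ... | yes mi≡i = subst S (sym mi≡i) i∈
  ... | no mi≢i = proj₁ (valid m λ mmi≡mi → mi≢i (trans (sym mmi≡mi) (involutive m i)))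

  matching⇒colouring : ∀ {S} (S? : Decidable S) (m : Matching S) →
                       ∃ λ k → ∃ λ c → ColouringOf S k c × k ℕ.+ k ≡ count S? ℕ.+ missed S? (mate m)
  matching⇒colouring S? m = pairs⇒colouring (mate m) (involutive m) near-sym _ S? ℕ.≤-refl
    (matching-closed m) (λ _ → proj₂ ∘ valid m)

  -- The number of missed vertices has the parity of the number of vertices.
  missed-gap : ∀ {S} (S? : Decidable S) (m m′ : Matching S) → missed S? (mate m) ℕ.< missed S? (mate m′) →
               2 ℕ.+ missed S? (mate m) ℕ.≤ missed S? (mate m′)
  missed-gap S? m m′ m<m′ with matching⇒colouring S? m | matching⇒colouring S? m′
  ... | k , _ , _ , k+k≡ | k′ , _ , _ , k′+k′≡ = ℕ.+-cancelˡ-≤ (count S?) _ _ (begin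
    count S? ℕ.+ (2 ℕ.+ missed S? (mate m))  ≡⟨ swap (count S?) (missed S? (mate m)) ⟩
    2 ℕ.+ (count S? ℕ.+ missed S? (mate m))  ≡⟨ cong (2 ℕ.+_) k+k≡ ⟨
    2 ℕ.+ (k ℕ.+ k)                          ≡⟨ cong suc (ℕ.+-suc k k) ⟨
    suc k ℕ.+ suc k                        ≤⟨ ℕ.+-mono-≤ k<k′ k<k′ ⟩
    k′ ℕ.+ k′                              ≡⟨ k′+k′≡ ⟩
    count S? ℕ.+ missed S? (mate m′)       ∎)
    where
    open ℕ.≤-Reasoning
    swap : ∀ a b → a ℕ.+ (2 ℕ.+ b) ≡ 2 ℕ.+ (a ℕ.+ b)
    swap = solve-∀
    k<k′ : k ℕ.< k′
    k<k′ = ℕ.≰⇒> λ k′≤k → ℕ.<⇒≱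
      (subst₂ ℕ._<_ (sym k+k≡) (sym k′+k′≡) (ℕ.+-monoʳ-< (count S?) m<m′)) (ℕ.+-mono-≤ k′≤k k′≤k)

  extend : ∀ {S S′ : Pred (Fin n) 0ℓ} → (∀ {i} → S′ i → S i) → Matching S′ → Matching S
  extend S′⊆S m = record { mate = mate m ; involutive = involutive m
                         ; valid = λ moved → S′⊆S (proj₁ (valid m moved)) , proj₂ (valid m moved) }

  extend-clique : ∀ {S S′ : Pred (Fin n) 0ℓ} → (∀ {i} → S′ i → S i) → CliqueIn S′ → CliqueIn S
  extend-clique S′⊆S Q = record { members? = members? Q ; members⊆ = S′⊆S ∘ members⊆ Q ; adjacent = adjacent Q }

  fixed-outside : ∀ {S} (m : Matching S) {i} → ¬ S i → mate m i ≡ i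
  fixed-outside m {i} i∉ = decidable-stable (mate m i Fin.≟ i) λ moved → i∉ (proj₁ (valid m moved))

  module _ {S : Pred (Fin n) 0ℓ} (S? : Decidable S) where

    -- Deleting a vertex covered by every maximum matching raises the number of missed vertices.
    essential-vertex : ∀ {v} → S v → (m : Matching S) → (∀ m′ → missed S? (mate m) ℕ.≤ missed S? (mate m′)) →
      ¬ (∃ λ m′ → missed S? (mate m′) ≡ missed S? (mate m) × mate m′ v ≡ v) → Balanced (S? ∖? v) → Balanced S?
    essential-vertex {v} v∈ m minimal covered (m′ , Q , bound) = m , extend-clique proj₁ Q , (begin
      count S? ℕ.+ missed S? (mate m)
        ≡⟨ cong (ℕ._+ missed S? (mate m)) (count-remove S? v∈) ⟩
      suc (count (S? ∖? v)) ℕ.+ missed S? (mate m)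
        ≡⟨ ℕ.+-suc (count (S? ∖? v)) (missed S? (mate m)) ⟨
      count (S? ∖? v) ℕ.+ suc (missed S? (mate m))
        -- Read in `S`, the matching `m′` also misses `v` and is not maximum, so by parity it misses
        -- at least two vertices more than `m`. One of the two offsets `v` being missed, the other
        -- the loss of `v` from the count.
        ≤⟨ ℕ.+-monoʳ-≤ (count (S? ∖? v)) (ℕ.s≤s⁻¹ (subst (2 ℕ.+ missed S? (mate m) ℕ.≤_) m″-missed
             (missed-gap S? m m″ (ℕ.≤∧≢⇒< (minimal m″) λ eq → covered (m″ , sym eq , m′v))))) ⟩
      count (S? ∖? v) ℕ.+ missed (S? ∖? v) (mate m′)
        ≤⟨ bound ⟩
      3 ℕ.* size Q ∎)
      where
      open ℕ.≤-Reasoning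
      m″ : Matching S
      m″ = extend proj₁ m′
      m′v : mate m′ v ≡ v
      m′v = fixed-outside m′ λ (_ , v≢v) → v≢v refl
      m″-missed : missed S? (mate m″) ≡ suc (missed (S? ∖? v) (mate m′))
      m″-missed = trans (count-remove (missed? S? (mate m″)) (v∈ , m′v))
        (cong suc (count-cong (missed? S? (mate m″) ∖? v) (missed? (S? ∖? v) (mate m′))
          (λ ((i∈ , mi) , i≢v) → (i∈ , i≢v) , mi) (λ ((i∈ , i≢v) , mi) → (i∈ , mi) , i≢v)))

    -- As all pairs across are near, a clique of one part and a clique of the other unite to a
    -- clique, so the two bounds add up.
    join : ∀ {S₁ S₂ : Pred (Fin n) 0ℓ} (S₁? : Decidable S₁) (S₂? : Decidable S₂) →
           (∀ {i} → S i → S₁ i ⊎ S₂ i) → (∀ {i} → S₁ i → S i) → (∀ {i} → S₂ i → S i) → (∀ {i} → S₁ i → ¬ S₂ i) →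
           (∀ {i j} → S₁ i → S₂ j → Near i j) → Balanced S₁? → Balanced S₂? → Balanced S?
    join {S₁} {S₂} S₁? S₂? S⊆ S₁⊆ S₂⊆ disjoint cross (m₁ , Q₁ , bound₁) (m₂ , Q₂ , bound₂) = m , Q , (begin
      count S? ℕ.+ missed S? f
        ≡⟨ cong₂ ℕ._+_ (count-split S? S₁? S₂? S⊆ S₁⊆ S₂⊆ disjoint) missed-split ⟩
      count S₁? ℕ.+ count S₂? ℕ.+ (missed S₁? (mate m₁) ℕ.+ missed S₂? (mate m₂))
        ≡⟨ interchange (count S₁?) (count S₂?) (missed S₁? (mate m₁)) (missed S₂? (mate m₂)) ⟩
      count S₁? ℕ.+ missed S₁? (mate m₁) ℕ.+ (count S₂? ℕ.+ missed S₂? (mate m₂))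
        ≤⟨ ℕ.+-mono-≤ bound₁ bound₂ ⟩
      3 ℕ.* size Q₁ ℕ.+ 3 ℕ.* size Q₂
        ≡⟨ ℕ.*-distribˡ-+ 3 (size Q₁) (size Q₂) ⟨
      3 ℕ.* (size Q₁ ℕ.+ size Q₂)
        ≡⟨ cong (3 ℕ.*_) (count-split (members? Q) (members? Q₁) (members? Q₂) id inj₁ inj₂
             (λ i∈ i∈′ → disjoint (members⊆ Q₁ i∈) (members⊆ Q₂ i∈′))) ⟨
      3 ℕ.* size Q ∎)
      where
      open ℕ.≤-Reasoning
      interchange : ∀ a b c d → a ℕ.+ b ℕ.+ (c ℕ.+ d) ≡ a ℕ.+ c ℕ.+ (b ℕ.+ d)
      interchange = solve-∀
      f : Fin n → Fin n
      f i with S₁? i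
      ... | yes _ = mate m₁ i
      ... | no _ = mate m₂ i
      f-S₁ : ∀ {i} → S₁ i → f i ≡ mate m₁ i
      f-S₁ {i} i∈ with S₁? i
      ... | yes _ = refl
      ... | no i∉ = contradiction i∈ i∉
      f-∉S₁ : ∀ {i} → ¬ S₁ i → f i ≡ mate m₂ i
      f-∉S₁ {i} i∉ with S₁? i
      ... | yes i∈ = contradiction i∈ i∉
      ... | no _ = refl
      mate₂-∉S₁ : ∀ {i} → ¬ S₁ i → ¬ S₁ (mate m₂ i)
      mate₂-∉S₁ {i} i∉ with mate m₂ i Fin.≟ i
      ... | yes mi≡i = i∉ ∘ subst S₁ mi≡i
      ... | no mi≢i = λ i∈ → disjoint i∈ (matching-closed m₂ (proj₁ (valid m₂ mi≢i)))
      m : Matching S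
      m .mate = f
      m .involutive i with S₁? i
      ... | yes i∈ = trans (f-S₁ (matching-closed m₁ i∈)) (involutive m₁ i)
      ... | no i∉ = trans (f-∉S₁ (mate₂-∉S₁ i∉)) (involutive m₂ i)
      m .valid {i} moved with S₁? i
      ... | yes _ = S₁⊆ (proj₁ (valid m₁ moved)) , proj₂ (valid m₁ moved)
      ... | no _ = S₂⊆ (proj₁ (valid m₂ moved)) , proj₂ (valid m₂ moved)
      missed-split : missed S? f ≡ missed S₁? (mate m₁) ℕ.+ missed S₂? (mate m₂)
      missed-split = count-split (missed? S? f) (missed? S₁? (mate m₁)) (missed? S₂? (mate m₂))
        (λ (i∈ , fi) → [ (λ i∈₁ → inj₁ (i∈₁ , trans (sym (f-S₁ i∈₁)) fi))
                       , (λ i∈₂ → inj₂ (i∈₂ , trans (sym (f-∉S₁ λ i∈₁ → disjoint i∈₁ i∈₂)) fi)) ]′ (S⊆ i∈))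
        (λ (i∈ , mi) → S₁⊆ i∈ , trans (f-S₁ i∈) mi)
        (λ (i∈ , mi) → S₂⊆ i∈ , trans (f-∉S₁ λ i∈₁ → disjoint i∈₁ i∈) mi)
        (λ (i∈ , _) (i∈′ , _) → disjoint i∈ i∈′)
      Q : CliqueIn S
      Q = record
        { members? = λ i → members? Q₁ i ⊎-dec members? Q₂ i
        ; members⊆ = [ S₁⊆ ∘ members⊆ Q₁ , S₂⊆ ∘ members⊆ Q₂ ]′
        ; adjacent = λ { (inj₁ i∈) (inj₁ j∈) → adjacent Q₁ i∈ j∈
                       ; (inj₁ i∈) (inj₂ j∈) → cross (members⊆ Q₁ i∈) (members⊆ Q₂ j∈)
                       ; (inj₂ i∈) (inj₁ j∈) → near-sym (cross (members⊆ Q₁ j∈) (members⊆ Q₂ i∈))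
                       ; (inj₂ i∈) (inj₂ j∈) → adjacent Q₂ i∈ j∈ }
        }

  -- Strong induction on the size of `S`. The double negation is there because the least number of
  -- missed vertices and the tests for avoidable vertices and exclusive pairs are obtained
  -- classically.
  balanced : ∀ b {S : Pred (Fin n) 0ℓ} (S? : Decidable S) → count S? ℕ.< b → ¬ ¬ Balanced S?
  balanced (suc b) {S} S? (s≤s S≤b) with Fin.any? S?
  ... | no ¬S = λ ¬balanced → ¬balanced (unmatched , empty-clique , ℕ.≤-trans (ℕ.≤-reflexive
          (cong₂ ℕ._+_ (count-empty S? λ i i∈ → ¬S (i , i∈)) (count-empty (missed? S? id) λ i (i∈ , _) → ¬S (i , i∈))))
          z≤n)
  ... | yes (u , u∈) = λ ¬balanced → ¬¬-least {P = λ μ → ∃ λ (m : Matching S) → missed S? (mate m) ≡ μ} (unmatched , refl)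
          λ { (_ , (m , refl) , least) → ¬¬-all (λ v → ¬¬-excluded-middle)
          λ avoidable? → from-maximum m (λ m′ → least (m′ , refl)) avoidable? ¬balanced }
    where
    open Rewiring Near near-sym S?
    module _ (m : Matching S) (minimal : ∀ (m′ : Matching S) → missed S? (mate m) ℕ.≤ missed S? (mate m′)) where
      open Maximum minimal

      -- The class of `u` under `Exclusive` stands in for a component of H: by transitivity, an edge
      -- of H leaving it would make its far end exclusive with `u`. If the class is all of `S`, a
      -- maximum matching missing `u` misses nothing else, and the bound of `third-clique` is just
      -- enough.
      all-avoidable : (∀ {v} → S v → ∃ λ m′ → Maximal m′ × mate m′ v ≡ v) →
                      (∀ i → Dec (Exclusive u i)) → ¬ ¬ Balanced S?
      all-avoidable avoid exclusive? with Fin.any? (λ i → S? i ×-dec ¬? ((i Fin.≟ u) ⊎-dec exclusive? i))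
      ... | yes (w , w∈₂) = λ ¬balanced →
              balanced b S₁? (ℕ.<-≤-trans (count-mono-< S₁? S? proj₁ (proj₁ w∈₂) λ (_ , w∈₁) → proj₂ w∈₂ w∈₁) S≤b) λ balanced₁ →
              balanced b S₂? (ℕ.<-≤-trans (count-mono-< S₂? S? proj₁ u∈ λ (_ , u∉) → u∉ (inj₁ refl)) S≤b) λ balanced₂ →
              ¬balanced (join S? S₁? S₂? split proj₁ proj₁ (λ (_ , i∈) (_ , i∉) → i∉ i∈) cross balanced₁ balanced₂)
        where
        Class S₁ S₂ : Pred (Fin n) 0ℓ
        Class i = i ≡ u ⊎ Exclusive u i
        class? : Decidable Class
        class? i = (i Fin.≟ u) ⊎-dec exclusive? i
        S₁ i = S i × Class i
        S₂ i = S i × ¬ Class i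
        S₁? : Decidable S₁
        S₁? i = S? i ×-dec class? i
        S₂? : Decidable S₂
        S₂? i = S? i ×-dec ¬? (class? i)
        split : ∀ {i} → S i → S₁ i ⊎ S₂ i
        split {i} i∈ with class? i
        ... | yes ci = inj₁ (i∈ , ci)
        ... | no ¬ci = inj₂ (i∈ , ¬ci)
        cross : ∀ {i j} → S₁ i → S₂ j → Near i j
        cross {i} {j} (i∈ , ci) (j∈ , ¬cj) = decidable-stable (near? i j) λ ¬ij →
          ¬cj (inj₂ (linked ci λ m′ m′-max m′i m′j → missed-near m′ m′-max (i∈ , m′i) (j∈ , m′j)
            (λ { refl → ¬ij (near-refl i) }) ¬ij))
          where
          linked : Class i → Exclusive i j → Exclusive u j
          linked (inj₁ refl) ij = ij
          linked (inj₂ ui) ij = exclusive-trans u∈ j∈ i∈ (λ u≡j → ¬cj (inj₁ (sym u≡j))) (avoid i∈) ui ij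
      ... | no all-linked = λ ¬balanced →
              let m′ , m′-max , m′u = avoid u∈
                  Q , bound = third-clique S? u∈
              in ¬balanced (m′ , Q , ℕ.≤-trans (ℕ.≤-reflexive (trans
                (cong (count S? ℕ.+_) (trans
                  (count-cong (missed? S? (mate m′)) (Fin._≟ u)
                    (λ {i} (i∈ , m′i) → decidable-stable (i Fin.≟ u) λ i≢u → all-linked
                      (i , i∈ , [ i≢u , (λ ui → ui m′ m′-max m′u m′i) ]′))
                    (λ { refl → u∈ , m′u }))
                  (count-singleton u)))
                (ℕ.+-comm (count S?) 1))) bound)

      from-maximum : (∀ v → Dec (∃ λ m′ → Maximal m′ × mate m′ v ≡ v)) → ¬ ¬ Balanced S?
      from-maximum avoidable? with Fin.any? (λ v → S? v ×-dec ¬? (avoidable? v))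
      ... | yes (v , v∈ , unavoidable) = λ ¬balanced →
              balanced b (S? ∖? v) (ℕ.<-≤-trans (count-mono-< (S? ∖? v) S? proj₁ v∈ λ (_ , v≢v) → v≢v refl) S≤b) λ balanced′ →
              ¬balanced (essential-vertex S? v∈ m minimal unavoidable balanced′)
      ... | no all = λ ¬balanced → ¬¬-all (λ _ → ¬¬-excluded-middle) λ exclusive? →
              all-avoidable (λ {v} v∈ → decidable-stable (avoidable? v) λ ¬avoid → all (v , v∈ , ¬avoid)) exclusive? ¬balanced

-- Rational models of finite sets of real points

at : ℕ → Point → Pt
at m (x , y) = seq x m , seq y m

½+½ : ∀ p → ½ * p + ½ * p ≡ p
½+½ = solve 1 (λ p → con ½ :* p :+ con ½ :* p := p) refl

square-mono : ∀ {p q} → 0ℚ ≤ p → p ≤ q → p * p ≤ q * q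
square-mono 0≤p p≤q = *-mono-≤-nonNeg (≤-trans 0≤p p≤q) 0≤p p≤q p≤q

square-mono-< : ∀ {p q} → 0ℚ < p → p < q → p * p < q * q
square-mono-< {p} {q} 0<p p<q = <-≤-trans (*-monoʳ-<-pos p {{positive 0<p}} p<q)
  (*-monoʳ-≤-nonNeg q {{nonNegative (<⇒≤ (<-trans 0<p p<q))}} (<⇒≤ p<q))

Eventually : (ℕ → Set) → Set
Eventually R = ∃ λ N → ∀ m → N ℕ.≤ m → R m

module SquareRoot (x : ℝ) (d² : ℕ → ℚ) (s≥0 : ∀ m → 0ℚ ≤ seq x m) (s-lower : ∀ m → seq x m * seq x m ≤ d² m)
                  (s-upper : ∀ m → d² m < (seq x m + + 1 / suc m) * (seq x m + + 1 / suc m)) where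

  -- Half of η absorbs the error in the distance, the other half the error 1/(m+1) of the
  -- approximate root.
  ≤1⇒near : x ≤ᴿ 1ᴿ → ∀ {η} → 0ℚ < η → Eventually λ m → d² m ≤ (1ℚ + η) * (1ℚ + η)
  ≤1⇒near d≤1 {η} 0<η =
    let M , s≤ = d≤1 (½*-pos 0<η)
        N , δ≤ = 1/N≤ (½*-pos 0<η)
    in M ℕ.⊔ N , λ m ≤m → ≤-trans (<⇒≤ (s-upper m))
         (square-mono (s≥0 m ⊕ 0≤fraction 1 m)
           (≤-trans (+-mono-≤ (s≤ (ℕ.m⊔n≤o⇒m≤o M N ≤m)) (δ≤ (ℕ.m⊔n≤o⇒n≤o M N ≤m)))
             (≤-reflexive (trans (+-assoc 1ℚ (½ * η) (½ * η)) (cong (λ z → 1ℚ + z) (½+½ η))))))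

  -- The alternatives overlap, so one rational comparison with 1 + 2η decides, at an index from
  -- which on the sequence varies by at most η.
  dichotomy : ∀ {η} → 0ℚ < η → Eventually (λ m → seq x m ≤ 1ℚ + (η + η + η)) ⊎ Eventually (λ m → 1ℚ + η < seq x m)
  dichotomy {η} 0<η with cauchy (x) 0<η
  ... | N , close with seq x N ≤? 1ℚ + (η + η)
  ...   | yes sN≤ = inj₁ (N , λ m ≤m →
            slack (p≤q⇒0≤q-p (≤+abs {seq x m} {seq x N} (close ≤m ℕ.≤-refl)) ⊕ p≤q⇒0≤q-p sN≤)
              (solve 3 (λ sN sm η → (sN :+ η :- sm) :+ (con 1ℚ :+ (η :+ η) :- sN)
                                 := con 1ℚ :+ (η :+ η :+ η) :- sm) refl (seq x N) (seq x m) η))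
  ...   | no sN≰ = inj₂ (N , λ m ≤m → ≰⇒> λ sm≤ → sN≰ (≤-trans
            (≤+abs {seq x N} {seq x m} (close ℕ.≤-refl ≤m))
            (slack (p≤q⇒0≤q-p sm≤) (solve 2 (λ sm η → con 1ℚ :+ η :- sm := con 1ℚ :+ (η :+ η) :- (sm :+ η))
              refl (seq x m) η))))

  -- The dichotomy is applied with η = ε/4, so that 3η ≤ ε. If its first side held for every ε, then
  -- x ≤ 1 would follow; its second side provides the gap.
  ≰1⇒far : ¬ x ≤ᴿ 1ᴿ →
    ¬ ¬ ∃ λ η → 0ℚ < η × Eventually λ m → (1ℚ + η) * (1ℚ + η) < d² m
  ≰1⇒far d≰1 ¬far = d≰1 λ {ε} 0<ε → bound ε 0<ε (dichotomy (½*-pos (½*-pos 0<ε)))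
    where
    bound : ∀ ε → 0ℚ < ε → let η = ½ * (½ * ε) in
            Eventually (λ m → seq x m ≤ 1ℚ + (η + η + η)) ⊎ Eventually (λ m → 1ℚ + η < seq x m) →
            ∃ λ N → ∀ {m} → N ℕ.≤ m → seq x m ≤ 1ℚ + ε
    bound ε 0<ε (inj₁ (N , s≤)) = N , λ {m} ≤m → ≤-trans (s≤ m ≤m)
      (slack (<⇒≤ (½*-pos (½*-pos 0<ε))) (solve 1 (λ ε → let η = con ½ :* (con ½ :* ε) in
        η := con 1ℚ :+ ε :- (con 1ℚ :+ (η :+ η :+ η))) refl ε))
    bound ε 0<ε (inj₂ (N , <s)) = contradiction
      (½ * (½ * ε) , ½*-pos (½*-pos 0<ε) , N , λ m ≤m →
        <-≤-trans (square-mono-< (+-pos (positive⁻¹ 1ℚ) (½*-pos (½*-pos 0<ε))) (<s m ≤m)) (s-lower m))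
      ¬far

module _ (p q : Point) where

  private
    d²≥0 : ∀ m → 0ℚ ≤ sq (at m p) (at m q)
    d²≥0 m = 0≤sq (at m p) (at m q)

    s≡ : ∀ m → seq (dist p q) m ≡ √-approx m (sq (at m p) (at m q))
    s≡ m = cong (√-approx m) (p≥q⇒p⊔q≡p (d²≥0 m))

    s≥0 : ∀ m → 0ℚ ≤ seq (dist p q) m
    s≥0 m = subst (0ℚ ≤_) (sym (s≡ m)) (√-approx-nonNeg m (d²≥0 m))

    s-lower : ∀ m → seq (dist p q) m * seq (dist p q) m ≤ sq (at m p) (at m q)
    s-lower m = subst (λ s → s * s ≤ sq (at m p) (at m q)) (sym (s≡ m)) (√-approx-lower m (d²≥0 m))

    s-upper : ∀ m → sq (at m p) (at m q) < (seq (dist p q) m + + 1 / suc m) * (seq (dist p q) m + + 1 / suc m)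
    s-upper m = subst (λ s → sq (at m p) (at m q) < (s + + 1 / suc m) * (s + + 1 / suc m)) (sym (s≡ m))
                  (√-approx-upper m (d²≥0 m))

  adjacent⇒near : dist p q ≤ᴿ 1ᴿ → ∀ {η} → 0ℚ < η →
                  Eventually λ m → sq (at m p) (at m q) ≤ (1ℚ + η) * (1ℚ + η)
  adjacent⇒near = SquareRoot.≤1⇒near (dist p q) (λ m → sq (at m p) (at m q)) s≥0 s-lower s-upper

  nonadjacent⇒far : ¬ dist p q ≤ᴿ 1ᴿ →
    ¬ ¬ ∃ λ η → 0ℚ < η × Eventually λ m → (1ℚ + η) * (1ℚ + η) < sq (at m p) (at m q)
  nonadjacent⇒far = SquareRoot.≰1⇒far (dist p q) (λ m → sq (at m p) (at m q)) s≥0 s-lower s-upper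

-- An adjacent pair tolerates every small η, a non-adjacent one only those up to its gap. A common η
-- for the finitely many pairs is fixed before the common index, which depends on it.
ForSmall : (ℚ → Set) → Set
ForSmall R = ∃ λ η₀ → 0ℚ < η₀ × (∀ {η} → 0ℚ < η → η ≤ η₀ → R η)

eventually-all : ∀ {n} {R : Fin n → ℕ → Set} → (∀ i → Eventually (R i)) → Eventually λ m → ∀ i → R i m
eventually-all {zero} _ = 0 , λ _ _ ()
eventually-all {suc n} ev =
  let M , h = ev zero
      N , hs = eventually-all (λ i → ev (suc i))
  in M ℕ.⊔ N , λ m ≤m → λ { zero → h m (ℕ.m⊔n≤o⇒m≤o M N ≤m) ; (suc i) → hs m (ℕ.m⊔n≤o⇒n≤o M N ≤m) i }

for-small-all : ∀ {n} {R : Fin n → ℚ → Set} → (∀ i → ForSmall (R i)) → ForSmall λ η → ∀ i → R i η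
for-small-all {zero} _ = 1ℚ , positive⁻¹ 1ℚ , λ _ _ ()
for-small-all {suc n} fs with fs zero | for-small-all (λ i → fs (suc i))
... | a , 0<a , h | b , 0<b , hs with ≤-total a b
...   | inj₁ a≤b = a , 0<a , λ 0<η ≤a → λ { zero → h 0<η ≤a ; (suc i) → hs 0<η (≤-trans ≤a a≤b) i }
...   | inj₂ b≤a = b , 0<b , λ 0<η ≤b → λ { zero → h 0<η (≤-trans ≤b b≤a) ; (suc i) → hs 0<η ≤b i }

module _ {n : ℕ} (p : Fin n → Point) where

  Adjacent : Fin n → Fin n → Set
  Adjacent i j = i ≢ j × dist (p i) (p j) ≤ᴿ 1ᴿ

  Decided : Fin n → Fin n → ℚ → ℕ → Set
  Decided i j η m = i ≢ j →
      Adjacent i j × sq (at m (p i)) (at m (p j)) ≤ (1ℚ + η) * (1ℚ + η)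
    ⊎ ¬ Adjacent i j × (1ℚ + η) * (1ℚ + η) < sq (at m (p i)) (at m (p j))

  decided : ∀ i j → ¬ ¬ ForSmall λ η → Eventually (Decided i j η)
  decided i j ¬decided = by-cases (i Fin.≟ j)
    where
    by-cases : ¬ Dec (i ≡ j)
    by-cases (yes i≡j) = ¬decided (1ℚ , positive⁻¹ 1ℚ , λ _ _ → 0 , λ _ _ i≢j → contradiction i≡j i≢j)
    by-cases (no i≢j) = ¬¬-excluded-middle {A = Adjacent i j} λ
      { (yes adj) → ¬decided (1ℚ , positive⁻¹ 1ℚ , λ 0<η _ →
          let N , near = adjacent⇒near (p i) (p j) (proj₂ adj) 0<η in N , λ m ≤m _ → inj₁ (adj , near m ≤m))
      ; (no ¬adj) → nonadjacent⇒far (p i) (p j) (λ d≤1 → ¬adj (i≢j , d≤1)) λ (η₀ , 0<η₀ , N , far) →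
          ¬decided (η₀ , 0<η₀ , λ 0<η η≤η₀ → N , λ m ≤m _ → inj₂ (¬adj , ≤-<-trans
            (square-mono (<⇒≤ (+-pos (positive⁻¹ 1ℚ) 0<η)) (+-monoʳ-≤ 1ℚ η≤η₀)) (far m ≤m))) }

  -- Truncating the coordinates far enough out yields rational points with the same
  -- adjacencies, for a threshold slightly above 1.
  rational-model : ¬ ¬ ∃ λ P → ∃ λ t → 0ℚ < t × (∀ i j → i ≢ j →
    Adjacent i j × sq (P i) (P j) ≤ t ⊎ ¬ Adjacent i j × t < sq (P i) (P j))
  rational-model ¬model = ¬¬-all (λ i → ¬¬-all (decided i)) λ all →
    let η , 0<η , small = for-small-all λ i → for-small-all (all i)
        N , late = eventually-all λ i → eventually-all (small 0<η ≤-refl i)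
    in ¬model ((λ i → at N (p i)) , (1ℚ + η) * (1ℚ + η)
              , *-pos (+-pos (positive⁻¹ 1ℚ) 0<η) (+-pos (positive⁻¹ 1ℚ) 0<η) , late N ℕ.≤-refl)

-- Transfer of the bound to the original graph

subset : ∀ {n} {P : Pred (Fin n) 0ℓ} → Decidable P → Subset n
subset P? = tabulate λ i → does (P? i)

∈-subset⁻ : ∀ {n} {P : Pred (Fin n) 0ℓ} (P? : Decidable P) {i} → i ∈ subset P? → P i
∈-subset⁻ P? {i} i∈ with P? i | trans (sym (lookup∘tabulate (λ i → does (P? i)) i)) ([]=⇒lookup i∈)
... | yes pi | _ = pi
... | no _ | ()

∣subset∣ : ∀ {n} {P : Pred (Fin n) 0ℓ} (P? : Decidable P) → ∣ subset P? ∣ ≡ count P?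
∣subset∣ {zero} P? = refl
∣subset∣ {suc n} P? with P? zero
... | yes _ = cong suc (∣subset∣ (λ i → P? (suc i)))
... | no _ = ∣subset∣ (λ i → P? (suc i))

module _ (G : Graph) {α ω χ : ℕ} (isStability : IsStability G α) (isCliqueNumber : IsCliqueNumber G ω)
         (isChromaticNumber : IsChromaticNumber G χ) (α≤2 : α ℕ.≤ 2) where
  open Graph G using (order; _~_; irrefl)

  module _ (P : Fin order → Pt) {t : ℚ} (0<t : 0ℚ < t)
           (model : ∀ i j → i ≢ j → i ~ j × sq (P i) (P j) ≤ t ⊎ ¬ i ~ j × t < sq (P i) (P j)) where

    open Planar P 0<t using (Near; near?; near-refl; near-sym; good-vertex)

    adjacent⇒Near : ∀ {i j} → i ~ j → Near i j
    adjacent⇒Near {i} {j} i~j with model i j (λ i≡j → irrefl i≡j i~j)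
    ... | inj₁ (_ , near) = near
    ... | inj₂ (i≁j , _) = contradiction i~j i≁j

    Near⇒adjacent : ∀ {i j} → i ≢ j → Near i j → i ~ j
    Near⇒adjacent {i} {j} i≢j near with model i j i≢j
    ... | inj₁ (i~j , _) = i~j
    ... | inj₂ (_ , far) = contradiction (<-≤-trans far near) (<-irrefl refl)

    -- Three pairwise far points are distinct, as `Near` is reflexive, and would form a stable set
    -- of size three.
    no-far-triple : ∀ {i j k} → ¬ Near i j → ¬ Near i k → Near j k
    no-far-triple {i} {j} {k} ¬ij ¬ik = decidable-stable (near? j k) λ ¬jk →
      ℕ.<⇒≱ (three ¬jk) (ℕ.≤-trans (proj₂ isStability (subset triple? , stable ¬jk , refl)) α≤2)
      where
      Triple : Pred (Fin order) 0ℓ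
      Triple x = x ≡ i ⊎ x ≡ j ⊎ x ≡ k
      triple? : Decidable Triple
      triple? x = (x Fin.≟ i) ⊎-dec (x Fin.≟ j) ⊎-dec (x Fin.≟ k)
      far⇒≢ : ∀ {x y} → ¬ Near x y → x ≢ y
      far⇒≢ {x} ¬xy refl = ¬xy (near-refl x)
      three : ¬ Near j k → 3 ℕ.≤ ∣ subset triple? ∣
      three ¬jk = ℕ.≤-trans (ℕ.≤-trans (ℕ.+-monoʳ-≤ 2 (ℕ.≤-trans (ℕ.s≤s ℕ.z≤n) (ℕ.≤-reflexive (sym
          (count-remove (triple? ∖? i ∖? j) ((inj₂ (inj₂ refl) , far⇒≢ ¬ik ∘ sym) , far⇒≢ ¬jk ∘ sym))))))
        (ℕ.≤-reflexive (sym (count-remove₂ triple? (inj₁ refl) (inj₂ (inj₁ refl)) (far⇒≢ ¬ij)))))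
        (ℕ.≤-reflexive (sym (∣subset∣ triple?)))
      far : ¬ Near j k → ∀ {x y} → Triple x → Triple y → x ≢ y → ¬ Near x y
      far _ (inj₁ refl) (inj₁ refl) x≢x = contradiction refl x≢x
      far _ (inj₁ refl) (inj₂ (inj₁ refl)) _ = ¬ij
      far _ (inj₁ refl) (inj₂ (inj₂ refl)) _ = ¬ik
      far _ (inj₂ (inj₁ refl)) (inj₁ refl) _ = ¬ij ∘ near-sym
      far _ (inj₂ (inj₁ refl)) (inj₂ (inj₁ refl)) x≢x = contradiction refl x≢x
      far ¬jk (inj₂ (inj₁ refl)) (inj₂ (inj₂ refl)) _ = ¬jk
      far _ (inj₂ (inj₂ refl)) (inj₁ refl) _ = ¬ik ∘ near-sym
      far ¬jk (inj₂ (inj₂ refl)) (inj₂ (inj₁ refl)) _ = ¬jk ∘ near-sym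
      far _ (inj₂ (inj₂ refl)) (inj₂ (inj₂ refl)) x≢x = contradiction refl x≢x
      stable : ¬ Near j k → Graph.Stable G (subset triple?)
      stable ¬jk x∈ y∈ x≢y x~y =
        far ¬jk (∈-subset⁻ triple? x∈) (∈-subset⁻ triple? y∈) x≢y (adjacent⇒Near x~y)

    open Matchings Near
    open Cover Near near? near-refl near-sym no-far-triple (good-vertex no-far-triple)

    all? : Decidable {A = Fin order} U
    all? _ = yes _

    clique≤ω : (Q : CliqueIn U) → CliqueIn.size Q ℕ.≤ ω
    clique≤ω Q = proj₂ isCliqueNumber (subset Q.members?
        , (λ i∈ j∈ i≢j → Near⇒adjacent i≢j (Q.adjacent (∈-subset⁻ Q.members? i∈) (∈-subset⁻ Q.members? j∈)))
        , ∣subset∣ Q.members?)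
      where module Q = CliqueIn Q

    χ≤colours : ∀ {k c} → ColouringOf U k c → χ ℕ.≤ k
    χ≤colours {k} {c} (c<k , proper) = proj₂ isChromaticNumber
      ( (λ i → fromℕ< (c<k {i} _))
      , λ {i} {j} i~j eq → proper {i} {j} _ _ (λ i≡j → irrefl i≡j i~j) (adjacent⇒Near i~j)
          (trans (sym (Fin.toℕ-fromℕ< (c<k {i} _))) (trans (cong toℕ eq) (Fin.toℕ-fromℕ< (c<k {j} _)))))

    balanced⇒bound : Balanced all? → 2 ℕ.* χ ℕ.≤ 3 ℕ.* ω
    balanced⇒bound (m , Q , bound) =
      let k , c , colouring , k+k≡ = matching⇒colouring all? m in begin
        2 ℕ.* χ                                      ≤⟨ ℕ.*-monoʳ-≤ 2 (χ≤colours colouring) ⟩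
        2 ℕ.* k                                      ≡⟨ cong (k ℕ.+_) (ℕ.+-identityʳ k) ⟩
        k ℕ.+ k                                      ≡⟨ k+k≡ ⟩
        count all? ℕ.+ missed all? (mate m)          ≤⟨ bound ⟩
        3 ℕ.* CliqueIn.size Q                        ≤⟨ ℕ.*-monoʳ-≤ 3 (clique≤ω Q) ⟩
        3 ℕ.* ω                                      ∎
      where open ℕ.≤-Reasoning

    ¬¬-bound : ¬ ¬ 2 ℕ.* χ ℕ.≤ 3 ℕ.* ω
    ¬¬-bound ¬bound = balanced _ all? ℕ.≤-refl (¬bound ∘ balanced⇒bound)

theorem2 : (G : UnitDiskGraph) (α ω χ : ℕ) →
    IsStability (graph G) α →
    IsCliqueNumber (graph G) ω →
    IsChromaticNumber (graph G) χ →
    α ℕ.≤ 2 →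
    (+ χ / 1) ≤ (+ 3 / 2) * (+ ω / 1)
theorem2 G α ω χ isStability isCliqueNumber isChromaticNumber α≤2 = *-cancelˡ-≤-pos (fromℕ 2)
  (subst₂ _≤_ (fromℕ-* 2 χ)
    (trans (fromℕ-* 3 ω) (*-assoc (fromℕ 2) (+ 3 / 2) (fromℕ ω)))
    -- With the denominator cleared, the inequality of naturals is decidable, which discharges the
    -- double negations of `rational-model` and `¬¬-bound`.
    (fromℕ-mono-≤ (decidable-stable (2 ℕ.* χ ℕ.≤? 3 ℕ.* ω) λ ¬bound → rational-model (UnitDiskGraph.point G)
      λ (P , _ , 0<t , model) → ¬¬-bound (graph G) isStability isCliqueNumber isChromaticNumber α≤2 P 0<t model ¬bound)))
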